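{- There is a constant $c>0$ such that the number of Graham classes of trees on $n$ vertices is $\Omega\!\left(e^{c(\log n)^{3/2}}\right)$ as $n\to\infty$.
   Context: All graphs are finite, simple and undirected; a tree is an acyclic connected graph. For a graph $G=(V,E)$ the line graph $L(G)$ has vertex set $E$, with distinct $e,f\in E$ adjacent iff $e\cap f\neq\emptyset$. Iterated line graphs: $L^{(0)}(G)=G$, $L^{(j+1)}(G)=L(L^{(j)}(G))$. Two trees $G,H$ are Graham equivalent if $|V(L^{(j)}(G))|=|V(L^{(j)}(H))|$ for all $j\ge 0$; the equivalence classes (of isomorphism classes of trees on $n$ vertices) are called Graham classes. -}

module Defs where

open import Data.Nat using (ℕ; zero; suc; _≡ᵇ_; _<ᵇ_; _≤_)
open import Data.Bool using (Bool; true; false; _∧_; _∨_; not)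
open import Data.Fin using (Fin; toℕ)
open import Data.List using (List; []; _∷_; _++_; length; lookup; concatMap; map; filterᵇ; allFin)
open import Data.List.Relation.Unary.Unique.Propositional using (Unique)
open import Data.Product using (Σ; _×_; _,_; proj₁; proj₂)
open import Data.Unit using (⊤)
open import Relation.Binary.PropositionalEquality using (_≡_; _≢_)
open import Relation.Nullary using (¬_)

-- A finite graph: vertex set Fin size, adjacency given by a Boolean matrix.
-- (Simplicity = symmetry + irreflexivity is imposed separately where needed.)
record Graph : Set where
  constructor graph
  field
    size : ℕ
    adj  : Fin size → Fin size → Bool
open Graph public

_==F_ : {n : ℕ} → Fin n → Fin n → Bool
i ==F j = toℕ i ≡ᵇ toℕ j

edges : (G : Graph) → List (Fin (size G) × Fin (size G))
edges G = concatMap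
  (λ i → map (λ j → (i , j))
             (filterᵇ (λ j → (toℕ i <ᵇ toℕ j) ∧ adj G i j) (allFin (size G))))
  (allFin (size G))

shareEnd : {n : ℕ} → (Fin n × Fin n) → (Fin n × Fin n) → Bool
shareEnd (u , v) (x , y) = (u ==F x) ∨ (u ==F y) ∨ (v ==F x) ∨ (v ==F y)

L : Graph → Graph
L G = graph (length (edges G))
            (λ a b → not (a ==F b) ∧ shareEnd (lookup (edges G) a) (lookup (edges G) b))

Liter : ℕ → Graph → Graph
Liter zero    G = G
Liter (suc j) G = L (Liter j G)

data Walk (G : Graph) : Fin (size G) → Fin (size G) → Set where
  here : ∀ {u} → Walk G u u
  step : ∀ {u w v} → adj G u w ≡ true → Walk G w v → Walk G u v

Chain : (G : Graph) → List (Fin (size G)) → Set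
Chain G []            = ⊤
Chain G (x ∷ [])      = ⊤
Chain G (x ∷ y ∷ r)   = (adj G x y ≡ true) × Chain G (y ∷ r)

HasCycle : Graph → Set
HasCycle G = Σ (Fin (size G)) λ x → Σ (Fin (size G)) λ y → Σ (Fin (size G)) λ z →
  Σ (List (Fin (size G))) λ rest →
    Unique (x ∷ y ∷ z ∷ rest) × Chain G ((x ∷ y ∷ z ∷ rest) ++ (x ∷ []))

IsSimple : Graph → Set
IsSimple G = (∀ i j → adj G i j ≡ adj G j i) × (∀ i → adj G i i ≡ false)

Connected : Graph → Set
Connected G = ∀ u v → Walk G u v

IsTree : Graph → Set
IsTree G = IsSimple G × Connected G × ¬ HasCycle G

GrahamEquiv : Graph → Graph → Set
GrahamEquiv G H = ∀ j → size (Liter j G) ≡ size (Liter j H)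

AtLeastGrahamClasses : ℕ → ℕ → Set
AtLeastGrahamClasses n K =
  Σ (Fin K → Graph) λ T →
    (∀ i → IsTree (T i) × size (T i) ≡ n) ×
    (∀ i j → i ≢ j → ¬ GrahamEquiv (T i) (T j))

{-# OPTIONS --safe #-}
module Submission where

-- Let T_x, for x ∈ {0,1}^k, be a path on n vertices cut into k long blocks, in which block i
-- starts with a star with 5i + 6 leaves if x_i = 1. If x ≠ y, let i be the last block in which
-- they differ, say x_i = 1 and y_i = 0. A vertex of L^j is built from at most j + 1 vertices of
-- the tree forming a connected set, so, while j is less than the block length, it either lies
-- beyond the star of block i, where T_x and T_y coincide, or among the blocks 0, …, i. Of the
-- latter kind T_x has at least |L^j(K_{1,5i+6})|, which beats the number for T_y, where only
-- smaller stars contribute: an edge uv has degree deg u + deg v − 2 in the line graph, hence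
-- degrees essentially double at each step, and the handshake lemma bounds the two counts
-- below and above by products whose ratio is about ((5i+3) / (5i+2))^j / n². For j of order
-- i log n this exceeds 1. As all these lengths are polylogarithmic, k = (log n)² is affordable.

open import Defs
open import Data.Bool using (Bool; true; false; _∧_; _∨_; not; if_then_else_)
open import Data.Bool.Properties using (∧-comm; ∨-comm; T-≡)
import Data.Bool.Properties as Bool
open import Data.Empty using (⊥; ⊥-elim)
open import Data.Fin using (Fin; toℕ; zero; suc; fromℕ<; finToFun; funToFin; combine)
import Data.Fin.Properties as Fin
open import Data.List using (List; []; _∷_; _++_; lookup; concatMap; map; filterᵇ; allFin; tabulate)
open import Data.List.Properties using (map-++; map-∘; map-tabulate)
open import Data.List.Relation.Unary.All using (All; []; _∷_)
open import Data.List.Relation.Unary.All.Properties using (All¬⇒¬Any)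
open import Data.List.Relation.Unary.AllPairs using ([]; _∷_)
open import Data.List.Relation.Unary.Any as Any using (Any)
open import Data.List.Relation.Unary.Unique.Propositional using (Unique)
open import Data.Nat
open import Data.Nat.DivMod
open import Data.Nat.Divisibility using (_∣_; ∣1⇒≡1; ∣m+n∣m⇒∣n; m%n≡0⇒n∣m)
open import Data.Nat.Induction using (<-wellFounded)
import Data.Nat.ListAction as List
open import Data.Nat.ListAction.Properties using (sum-++)
open import Data.Nat.Logarithm using (⌈log₂_⌉; ⌈log₂⌉-mono-≤; ⌈log₂2^n⌉≡n)
open import Data.Nat.Properties
open import Data.Nat.Solver using (module +-*-Solver)
open import Data.Product using (Σ; _×_; _,_; proj₁; proj₂; ∃)
open import Data.Sum using (_⊎_; inj₁; inj₂; [_,_]′)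
open import Data.Unit using (⊤; tt)
open import Function using (_∘_; id; Equivalence)
open import Induction.WellFounded using (Acc; acc)
open import Relation.Binary using (tri<; tri≈; tri>)
open import Relation.Binary.PropositionalEquality
open import Relation.Nullary using (¬_; yes; no)
open import Algebra.Properties.Semiring.Sum +-*-semiring using (sum; sum-cong-≗; ∑-distrib-+; ∑-comm; *-distribˡ-sum; sum-replicate-zero)

-- The comparison tolerates crude constants. Blocks 0, ..., i of T_y are allowed up to n² edges at
-- the start, against a single edge guaranteed in the star of T_x; this handicap is fixed, while the
-- ratio of the degree bounds is gained anew at every level. The delicate point is the -2 in the
-- degree of an edge: the lower bound follows the excess of the degrees over 2, which doubles
-- exactly, the upper bound follows the degrees themselves, and the number of leaves must grow fast
-- enough with i for the former to win. Depth and block length are tied together: the counts need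
-- about i log n levels to separate, and for all these levels whatever touches the first i + 1 stars
-- must stay clear of the next one. Connected vertex sets never appear in the code. A set of tree
-- vertices is a Boolean predicate, carried up one line graph at a time.

-- Booleans and order tests

𝟙 : Bool → ℕ
𝟙 true  = 1
𝟙 false = 0

𝟙-∧ : ∀ a b → 𝟙 (a ∧ b) ≡ 𝟙 a * 𝟙 b
𝟙-∧ true  b = sym (+-identityʳ _)
𝟙-∧ false b = refl

𝟙≤1 : ∀ a → 𝟙 a ≤ 1
𝟙≤1 true  = ≤-refl
𝟙≤1 false = z≤n

∧-true⁻ : ∀ {a b} → a ∧ b ≡ true → a ≡ true × b ≡ true
∧-true⁻ {true} {true} refl = refl , refl

∧-true⁺ : ∀ {a b} → a ≡ true → b ≡ true → a ∧ b ≡ true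
∧-true⁺ refl refl = refl

∨-true⁻ : ∀ {a b} → a ∨ b ≡ true → a ≡ true ⊎ b ≡ true
∨-true⁻ {true}         _ = inj₁ refl
∨-true⁻ {false} {true} _ = inj₂ refl

∨-true⁺ˡ : ∀ {a} b → a ≡ true → a ∨ b ≡ true
∨-true⁺ˡ b refl = refl

∨-true⁺ʳ : ∀ a {b} → b ≡ true → a ∨ b ≡ true
∨-true⁺ʳ true  _ = refl
∨-true⁺ʳ false p = p

true≢false : true ≢ false
true≢false ()

¬true⇒false : ∀ {a} → ¬ a ≡ true → a ≡ false
¬true⇒false {true}  h = ⊥-elim (h refl)
¬true⇒false {false} h = refl

<ᵇ-true : ∀ {m n} → m < n → (m <ᵇ n) ≡ true
<ᵇ-true m<n = Equivalence.to T-≡ (<⇒<ᵇ m<n)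

<ᵇ-true⁻ : ∀ {m n} → (m <ᵇ n) ≡ true → m < n
<ᵇ-true⁻ {m} {n} e = <ᵇ⇒< m n (Equivalence.from T-≡ e)

<ᵇ-false : ∀ {m n} → n ≤ m → (m <ᵇ n) ≡ false
<ᵇ-false n≤m = ¬true⇒false (λ e → <⇒≱ (<ᵇ-true⁻ e) n≤m)

≡ᵇ-true : ∀ {m n} → m ≡ n → (m ≡ᵇ n) ≡ true
≡ᵇ-true {m} {n} e = Equivalence.to T-≡ (≡⇒≡ᵇ m n e)

≡ᵇ-true⁻ : ∀ {m n} → (m ≡ᵇ n) ≡ true → m ≡ n
≡ᵇ-true⁻ {m} {n} e = ≡ᵇ⇒≡ m n (Equivalence.from T-≡ e)

==F-true⁻ : ∀ {n} {i j : Fin n} → (i ==F j) ≡ true → i ≡ j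
==F-true⁻ e = Fin.toℕ-injective (≡ᵇ-true⁻ e)

==F-refl : ∀ {n} (i : Fin n) → (i ==F i) ≡ true
==F-refl i = ≡ᵇ-true {toℕ i} refl

==F-false : ∀ {n} {i j : Fin n} → i ≢ j → (i ==F j) ≡ false
==F-false i≢j = ¬true⇒false (i≢j ∘ ==F-true⁻)

≡ᵇ-sym : ∀ m n → (m ≡ᵇ n) ≡ (n ≡ᵇ m)
≡ᵇ-sym zero    zero    = refl
≡ᵇ-sym zero    (suc n) = refl
≡ᵇ-sym (suc m) zero    = refl
≡ᵇ-sym (suc m) (suc n) = ≡ᵇ-sym m n

==F-sym : ∀ {n} (i j : Fin n) → (i ==F j) ≡ (j ==F i)
==F-sym i j = ≡ᵇ-sym (toℕ i) (toℕ j)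

-- Sums over Fin

sum-mono-≤ : ∀ {n} {f g : Fin n → ℕ} → (∀ i → f i ≤ g i) → sum f ≤ sum g
sum-mono-≤ {zero}  h = z≤n
sum-mono-≤ {suc n} h = +-mono-≤ (h zero) (sum-mono-≤ (h ∘ suc))

sum-zero : ∀ {n} (f : Fin n → ℕ) → (∀ i → f i ≡ 0) → sum f ≡ 0
sum-zero {n} f h = trans (sum-cong-≗ h) (sum-replicate-zero n)

sum-const : ∀ n c → sum {n} (λ _ → c) ≡ n * c
sum-const zero    c = refl
sum-const (suc n) c = cong (c +_) (sum-const n c)

term≤sum : ∀ {n} (f : Fin n → ℕ) i → f i ≤ sum f
term≤sum f zero    = m≤m+n _ _
term≤sum f (suc i) = ≤-trans (term≤sum (f ∘ suc) i) (m≤n+m _ _)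

two-terms≤sum : ∀ {n} (f : Fin n → ℕ) {i j} → i ≢ j → f i + f j ≤ sum f
two-terms≤sum f {zero}  {zero}  i≢j = ⊥-elim (i≢j refl)
two-terms≤sum f {zero}  {suc j} i≢j = +-monoʳ-≤ (f zero) (term≤sum (f ∘ suc) j)
two-terms≤sum f {suc i} {zero}  i≢j =
  subst (_≤ sum f) (+-comm (f zero) (f (suc i))) (+-monoʳ-≤ (f zero) (term≤sum (f ∘ suc) i))
two-terms≤sum f {suc i} {suc j} i≢j =
  ≤-trans (two-terms≤sum (f ∘ suc) (i≢j ∘ cong suc)) (m≤n+m _ _)

sum-pos⇒term-pos : ∀ {n} (f : Fin n → ℕ) → 1 ≤ sum f → ∃ λ i → 1 ≤ f i
sum-pos⇒term-pos {suc n} f h with f zero in eq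
... | suc c = zero , subst (1 ≤_) (sym eq) (s≤s z≤n)
... | zero with sum-pos⇒term-pos (f ∘ suc) h
...   | i , p = suc i , p

sum-δ : ∀ {n} (i : Fin n) (f : Fin n → ℕ) → sum (λ j → 𝟙 (i ==F j) * f j) ≡ f i
sum-δ zero f =
  trans (cong₂ _+_ (+-identityʳ (f zero)) (sum-zero (λ j → 𝟙 (zero ==F suc j) * f (suc j)) (λ _ → refl)))
        (+-identityʳ _)
sum-δ (suc i) f = sum-δ i (f ∘ suc)

cnt : ∀ {n} → (Fin n → Bool) → ℕ
cnt q = sum (λ i → 𝟙 (q i))

cnt≤size : ∀ {n} (q : Fin n → Bool) → cnt q ≤ n
cnt≤size {n} q = ≤-trans (sum-mono-≤ (λ i → 𝟙≤1 (q i))) (≤-reflexive (trans (sum-const n 1) (*-identityʳ n)))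

cnt-all : ∀ n → cnt {n} (λ _ → true) ≡ n
cnt-all n = trans (sum-const n 1) (*-identityʳ n)

cnt-subsingleton : ∀ {n} (q : Fin n → Bool) → (∀ i j → q i ≡ true → q j ≡ true → i ≡ j) → cnt q ≤ 1
cnt-subsingleton {zero}  q h = z≤n
cnt-subsingleton {suc n} q h with q zero in eq
... | false = cnt-subsingleton (q ∘ suc) (λ i j p r → Fin.suc-injective (h (suc i) (suc j) p r))
... | true  = ≤-reflexive (cong suc (sum-zero (λ i → 𝟙 (q (suc i)))
                (λ i → cong 𝟙 (¬true⇒false (λ e → Fin.0≢1+n (h zero (suc i) eq e))))))

-- Double counting in the 0-1 matrix `R` of the graph of `f`: each row selected by `q` has an entry,
-- and by injectivity each column has at most one, which lies in a column selected by `q′`.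
cnt-injection : ∀ {m n} (q : Fin m → Bool) (q′ : Fin n → Bool) (f : ∀ i → q i ≡ true → Fin n) →
  (∀ i p → q′ (f i p) ≡ true) → (∀ i j p r → f i p ≡ f j r → i ≡ j) → cnt q ≤ cnt q′
cnt-injection {m} {n} q q′ f into inj = begin
  cnt q                                       ≤⟨ sum-mono-≤ row ⟩
  sum (λ i → sum (λ y → 𝟙 (R i y)))           ≡⟨ ∑-comm (λ i y → 𝟙 (R i y)) ⟩
  sum (λ y → sum (λ i → 𝟙 (R i y)))           ≤⟨ sum-mono-≤ column ⟩
  cnt q′                                      ∎
  where
  open ≤-Reasoning
  -- `f` is defined only where `q` holds, so the value of `q i` is passed together with the equation
  -- that `f` needs.
  dec : ∀ i b → q i ≡ b → Fin n → Bool
  dec i true  p y = f i p ==F y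
  dec i false p y = false
  R : Fin m → Fin n → Bool
  R i = dec i (q i) refl
  R⁻ : ∀ i y b p → dec i b p y ≡ true → Σ (q i ≡ true) λ p′ → f i p′ ≡ y
  R⁻ i y true p e = p , ==F-true⁻ e
  row : ∀ i → 𝟙 (q i) ≤ sum (λ y → 𝟙 (R i y))
  row i = go (q i) refl
    where
    go : ∀ b p → 𝟙 b ≤ sum (λ y → 𝟙 (dec i b p y))
    go false p = z≤n
    go true  p = subst (λ z → 𝟙 z ≤ sum (λ y → 𝟙 (f i p ==F y))) (==F-refl (f i p))
                   (term≤sum (λ y → 𝟙 (f i p ==F y)) (f i p))
  unique : ∀ y i j → R i y ≡ true → R j y ≡ true → i ≡ j
  unique y i j e₁ e₂ with R⁻ i y (q i) refl e₁ | R⁻ j y (q j) refl e₂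
  ... | p , fp | r , fr = inj i j p r (trans fp (sym fr))
  column : ∀ y → sum (λ i → 𝟙 (R i y)) ≤ 𝟙 (q′ y)
  column y with q′ y in eq
  ... | true  = cnt-subsingleton (λ i → R i y) (unique y)
  ... | false = ≤-reflexive (sum-zero (λ i → 𝟙 (R i y)) (λ i → cong 𝟙 (¬true⇒false (absent i))))
    where
    absent : ∀ i → ¬ R i y ≡ true
    absent i e with R⁻ i y (q i) refl e
    ... | p , fp = true≢false (trans (sym (into i p)) (trans (cong q′ fp) eq))

-- The edge list

sum-lookup : ∀ {A : Set} (F : A → ℕ) (xs : List A) → sum (λ e → F (lookup xs e)) ≡ List.sum (map F xs)
sum-lookup F []       = refl
sum-lookup F (x ∷ xs) = cong (F x +_) (sum-lookup F xs)

sum-concatMap : ∀ {A B : Set} (F : B → ℕ) (g : A → List B) xs →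
  List.sum (map F (concatMap g xs)) ≡ List.sum (map (λ x → List.sum (map F (g x))) xs)
sum-concatMap F g []       = refl
sum-concatMap F g (x ∷ xs) = begin
  List.sum (map F (g x ++ concatMap g xs))
    ≡⟨ cong List.sum (map-++ F (g x) (concatMap g xs)) ⟩
  List.sum (map F (g x) ++ map F (concatMap g xs))
    ≡⟨ sum-++ (map F (g x)) _ ⟩
  List.sum (map F (g x)) + List.sum (map F (concatMap g xs))
    ≡⟨ cong (List.sum (map F (g x)) +_) (sum-concatMap F g xs) ⟩
  _ ∎
  where open ≡-Reasoning

sum-filterᵇ : ∀ {A : Set} (F : A → ℕ) (p : A → Bool) xs →
  List.sum (map F (filterᵇ p xs)) ≡ List.sum (map (λ x → 𝟙 (p x) * F x) xs)
sum-filterᵇ F p []       = refl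
sum-filterᵇ F p (x ∷ xs) with p x
... | true  = cong₂ _+_ (sym (+-identityʳ (F x))) (sum-filterᵇ F p xs)
... | false = sum-filterᵇ F p xs

sum-allFin : ∀ {n} (F : Fin n → ℕ) → List.sum (map F (allFin n)) ≡ sum F
sum-allFin F = trans (cong List.sum (map-tabulate id F)) (go F)
  where
  go : ∀ {n} (F : Fin n → ℕ) → List.sum (tabulate F) ≡ sum F
  go {zero}  F = refl
  go {suc n} F = cong (F zero +_) (go (F ∘ suc))

module _ (G : Graph) where

  private
    n = size G
    V = Fin (size G)

  ends : Fin (size (L G)) → V × V
  ends = lookup (edges G)

  isEdge : V → V → Bool
  isEdge i j = (toℕ i <ᵇ toℕ j) ∧ adj G i j

  sum-ends : (F : V × V → ℕ) →
    sum (λ e → F (ends e)) ≡ sum (λ i → sum (λ j → 𝟙 (isEdge i j) * F (i , j)))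
  sum-ends F = begin
    sum (λ e → F (ends e))
      ≡⟨ sum-lookup F (edges G) ⟩
    List.sum (map F (edges G))
      ≡⟨ sum-concatMap F row (allFin n) ⟩
    List.sum (map (λ i → List.sum (map F (row i))) (allFin n))
      ≡⟨ sum-allFin (λ i → List.sum (map F (row i))) ⟩
    sum (λ i → List.sum (map F (row i)))
      ≡⟨ sum-cong-≗ (λ i → trans (cong List.sum (sym (map-∘ (filterᵇ (isEdge i) (allFin n)))))
           (trans (sum-filterᵇ (λ j → F (i , j)) (isEdge i) (allFin n))
                  (sum-allFin (λ j → 𝟙 (isEdge i j) * F (i , j))))) ⟩
    _ ∎
    where
    open ≡-Reasoning
    row : V → List (V × V)
    row i = map (λ j → (i , j)) (filterᵇ (isEdge i) (allFin n))

  δ² : V × V → V × V → Bool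
  δ² (u , v) (x , y) = (u ==F x) ∧ (v ==F y)

  -- The left side counts the positions of (u , v) in the edge list. This one identity yields that
  -- every entry is an edge, that no edge is listed twice and that every edge is listed.
  sum-ends-δ² : ∀ u v → sum (λ e → 𝟙 (δ² (u , v) (ends e))) ≡ 𝟙 (isEdge u v)
  sum-ends-δ² u v = begin
    sum (λ e → 𝟙 (δ² (u , v) (ends e)))
      ≡⟨ sum-ends (λ xy → 𝟙 (δ² (u , v) xy)) ⟩
    sum (λ i → sum (λ j → 𝟙 (isEdge i j) * 𝟙 ((u ==F i) ∧ (v ==F j))))
      ≡⟨ sum-cong-≗ (λ i → trans (sum-cong-≗ (λ j → shuffle i j)) (sum-δ v _)) ⟩
    sum (λ i → 𝟙 (u ==F i) * 𝟙 (isEdge i v))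
      ≡⟨ sum-δ u _ ⟩
    𝟙 (isEdge u v) ∎
    where
    open ≡-Reasoning
    shuffle : ∀ i j → 𝟙 (isEdge i j) * 𝟙 ((u ==F i) ∧ (v ==F j)) ≡ 𝟙 (v ==F j) * (𝟙 (u ==F i) * 𝟙 (isEdge i j))
    shuffle i j = trans (cong (𝟙 (isEdge i j) *_) (𝟙-∧ (u ==F i) (v ==F j)))
      (solve 3 (λ a b c → a :* (b :* c) := c :* (b :* a)) refl (𝟙 (isEdge i j)) (𝟙 (u ==F i)) (𝟙 (v ==F j)))
      where open +-*-Solver

  δ²-refl : ∀ uv → δ² uv uv ≡ true
  δ²-refl (u , v) = ∧-true⁺ (==F-refl u) (==F-refl v)

  ends-isEdge : ∀ e → isEdge (proj₁ (ends e)) (proj₂ (ends e)) ≡ true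
  ends-isEdge e = go _ (subst (1 ≤_) (sum-ends-δ² u v)
      (subst (λ b → 𝟙 b ≤ cnt (λ f → δ² (ends e) (ends f))) (δ²-refl (ends e))
         (term≤sum (λ f → 𝟙 (δ² (ends e) (ends f))) e)))
    where
    u = proj₁ (ends e)
    v = proj₂ (ends e)
    go : ∀ b → 1 ≤ 𝟙 b → b ≡ true
    go true _ = refl

  ends-< : ∀ e → toℕ (proj₁ (ends e)) < toℕ (proj₂ (ends e))
  ends-< e = <ᵇ-true⁻ (proj₁ (∧-true⁻ (ends-isEdge e)))

  ends-adj : ∀ e → adj G (proj₁ (ends e)) (proj₂ (ends e)) ≡ true
  ends-adj e = proj₂ (∧-true⁻ {toℕ (proj₁ (ends e)) <ᵇ toℕ (proj₂ (ends e))} (ends-isEdge e))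

  ends-≢ : ∀ e → proj₁ (ends e) ≢ proj₂ (ends e)
  ends-≢ e eq = <⇒≢ (ends-< e) (cong toℕ eq)

  ends-injective : ∀ {e f} → ends e ≡ ends f → e ≡ f
  ends-injective {e} {f} eq with e Fin.≟ f
  ... | yes p = p
  ... | no e≢f = ⊥-elim (<⇒≱ (s≤s (s≤s z≤n)) (begin
      2                                              ≡⟨ cong₂ _+_ (cong 𝟙 (sym (δ²-refl (ends e))))
                                                          (cong 𝟙 (trans (sym (δ²-refl (ends e))) (cong (δ² (ends e)) eq))) ⟩
      𝟙 (δ² (ends e) (ends e)) + 𝟙 (δ² (ends e) (ends f)) ≤⟨ two-terms≤sum (λ g → 𝟙 (δ² (ends e) (ends g))) e≢f ⟩
      sum (λ g → 𝟙 (δ² (ends e) (ends g)))          ≡⟨ sum-ends-δ² _ _ ⟩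
      𝟙 (isEdge (proj₁ (ends e)) (proj₂ (ends e)))   ≤⟨ 𝟙≤1 _ ⟩
      1 ∎))
    where open ≤-Reasoning

  ends-surjective : ∀ {u v} → toℕ u < toℕ v → adj G u v ≡ true → ∃ λ e → ends e ≡ (u , v)
  ends-surjective {u} {v} u<v a =
    let e , p = sum-pos⇒term-pos (λ e → 𝟙 (δ² (u , v) (ends e)))
                  (≤-reflexive (sym (trans (sum-ends-δ² u v) (cong 𝟙 (∧-true⁺ (<ᵇ-true u<v) a)))))
    in e , go (ends e) p
    where
    go : ∀ xy → 1 ≤ 𝟙 (δ² (u , v) xy) → xy ≡ (u , v)
    go (x , y) p with u ==F x in a | v ==F y in b
    ... | true | true = sym (cong₂ _,_ (==F-true⁻ a) (==F-true⁻ b))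

-- Vertex sets and degrees in line graphs

lift : (G : Graph) → (Fin (size G) → Bool) → Fin (size (L G)) → Bool
lift G q e = q (proj₁ (ends G e)) ∧ q (proj₂ (ends G e))

-- The vertices of the j-th line graph of the subgraph induced by `q`, kept as a subset of those of
-- the j-th line graph of `G`. Thus induced subgraphs never have to be renumbered.
liftIter : (G : Graph) (j : ℕ) → (Fin (size G) → Bool) → Fin (size (Liter j G)) → Bool
liftIter G zero    q = q
liftIter G (suc j) q = lift (Liter j G) (liftIter G j q)

deg : (G : Graph) → (Fin (size G) → Bool) → Fin (size G) → ℕ
deg G q u = sum (λ w → 𝟙 (adj G u w) * 𝟙 (q w))

shareEnd-sym : ∀ {n} (e f : Fin n × Fin n) → shareEnd e f ≡ shareEnd f e
shareEnd-sym (u , v) (x , y)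
  rewrite ==F-sym x u | ==F-sym x v | ==F-sym y u | ==F-sym y v
  = bool (u ==F x) (u ==F y) (v ==F x) (v ==F y)
  where
  bool : ∀ a b c d → (a ∨ b ∨ c ∨ d) ≡ (a ∨ c ∨ b ∨ d)
  bool true  b     c     d = refl
  bool false true  true  d = refl
  bool false true  false d = refl
  bool false false true  d = refl
  bool false false false d = refl

L-simple : ∀ G → IsSimple (L G)
L-simple G = (λ e f → cong₂ (λ a b → not a ∧ b) (==F-sym e f) (shareEnd-sym (ends G e) (ends G f)))
           , (λ e → cong (λ a → not a ∧ shareEnd (ends G e) (ends G e)) (==F-refl e))

Liter-simple : ∀ {G} → IsSimple G → ∀ j → IsSimple (Liter j G)
Liter-simple     s zero    = s
Liter-simple {G} s (suc j) = L-simple (Liter j G)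

module _ {G : Graph} (simple : IsSimple G) where

  private
    V = Fin (size G)
    adj-sym = proj₁ simple

  adj⇒≢ : ∀ {u v} → adj G u v ≡ true → u ≢ v
  adj⇒≢ {u} a refl = true≢false (trans (sym a) (proj₂ simple u))

  orient : ∀ u v → 𝟙 (isEdge G u v) + 𝟙 (isEdge G v u) ≡ 𝟙 (adj G u v)
  orient u v rewrite adj-sym v u with adj G u v in a
  ... | false rewrite ∧-comm (toℕ u <ᵇ toℕ v) false | ∧-comm (toℕ v <ᵇ toℕ u) false = refl
  ... | true with <-cmp (toℕ u) (toℕ v)
  ...   | tri< u<v _ _ rewrite <ᵇ-true u<v | <ᵇ-false (<⇒≤ u<v) = refl
  ...   | tri> _ _ v<u rewrite <ᵇ-true v<u | <ᵇ-false (<⇒≤ v<u) = refl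
  ...   | tri≈ _ u≡v _ = ⊥-elim (adj⇒≢ a (Fin.toℕ-injective u≡v))

  -- The list stores each edge once, with its smaller end first. For a symmetric summand, doubling
  -- turns this into a sum over ordered pairs, where the numbering of the vertices no longer
  -- matters.
  sum-edges : (F : V × V → ℕ) → (∀ u v → F (u , v) ≡ F (v , u)) →
    2 * sum (λ e → F (ends G e)) ≡ sum (λ u → sum (λ v → 𝟙 (adj G u v) * F (u , v)))
  sum-edges F F-sym = begin
    2 * sum (λ e → F (ends G e))
      ≡⟨ cong (2 *_) (sum-ends G F) ⟩
    2 * S
      ≡⟨ cong (S +_) (+-identityʳ S) ⟩
    S + S
      ≡⟨ cong (S +_) (trans (∑-comm (λ u v → 𝟙 (isEdge G u v) * F (u , v)))
                      (sum-cong-≗ λ u → sum-cong-≗ λ v → cong (𝟙 (isEdge G v u) *_) (F-sym v u))) ⟩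
    S + sum (λ u → sum (λ v → 𝟙 (isEdge G v u) * F (u , v)))
      ≡⟨ sym (∑-distrib-+ (λ u → sum (λ v → 𝟙 (isEdge G u v) * F (u , v))) _) ⟩
    sum (λ u → sum (λ v → 𝟙 (isEdge G u v) * F (u , v)) + sum (λ v → 𝟙 (isEdge G v u) * F (u , v)))
      ≡⟨ sum-cong-≗ (λ u → trans (sym (∑-distrib-+ (λ v → 𝟙 (isEdge G u v) * F (u , v)) _))
           (sum-cong-≗ λ v → trans (sym (*-distribʳ-+ (F (u , v)) (𝟙 (isEdge G u v)) _))
              (cong (_* F (u , v)) (orient u v)))) ⟩
    _ ∎
    where
    open ≡-Reasoning
    S = sum (λ u → sum (λ v → 𝟙 (isEdge G u v) * F (u , v)))

  module _ (q : V → Bool) where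

    handshake : 2 * cnt (lift G q) ≡ sum (λ u → 𝟙 (q u) * deg G q u)
    handshake = begin
      2 * cnt (lift G q)
        ≡⟨ sum-edges (λ (u , v) → 𝟙 (q u ∧ q v)) (λ u v → cong 𝟙 (∧-comm (q u) (q v))) ⟩
      sum (λ u → sum (λ v → 𝟙 (adj G u v) * 𝟙 (q u ∧ q v)))
        ≡⟨ sum-cong-≗ (λ u → trans (sum-cong-≗ (λ v → shuffle u v)) (sym (*-distribˡ-sum (𝟙 (q u)) (λ v → 𝟙 (adj G u v) * 𝟙 (q v))))) ⟩
      _ ∎
      where
      open ≡-Reasoning
      shuffle : ∀ u v → 𝟙 (adj G u v) * 𝟙 (q u ∧ q v) ≡ 𝟙 (q u) * (𝟙 (adj G u v) * 𝟙 (q v))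
      shuffle u v = trans (cong (𝟙 (adj G u v) *_) (𝟙-∧ (q u) (q v)))
        (solve 3 (λ a b c → a :* (b :* c) := b :* (a :* c)) refl (𝟙 (adj G u v)) (𝟙 (q u)) (𝟙 (q v)))
        where open +-*-Solver

    handshake-≤ : ∀ r → (∀ u → q u ≡ true → deg G q u ≤ r) → 2 * cnt (lift G q) ≤ cnt q * r
    handshake-≤ r h = begin
      2 * cnt (lift G q)                    ≡⟨ handshake ⟩
      sum (λ u → 𝟙 (q u) * deg G q u)       ≤⟨ sum-mono-≤ bound ⟩
      sum (λ u → r * 𝟙 (q u))               ≡⟨ sym (*-distribˡ-sum r (λ u → 𝟙 (q u))) ⟩
      r * cnt q                             ≡⟨ *-comm r _ ⟩
      cnt q * r                             ∎
      where
      open ≤-Reasoning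
      bound : ∀ u → 𝟙 (q u) * deg G q u ≤ r * 𝟙 (q u)
      bound u with q u in eq
      ... | false = z≤n
      ... | true  = ≤-trans (≤-reflexive (+-identityʳ _)) (≤-trans (h u eq) (≤-reflexive (sym (*-identityʳ r))))

    handshake-≥ : ∀ r → (∀ u → q u ≡ true → r ≤ deg G q u) → cnt q * r ≤ 2 * cnt (lift G q)
    handshake-≥ r h = begin
      cnt q * r                             ≡⟨ *-comm _ r ⟩
      r * cnt q                             ≡⟨ *-distribˡ-sum r (λ u → 𝟙 (q u)) ⟩
      sum (λ u → r * 𝟙 (q u))               ≤⟨ sum-mono-≤ bound ⟩
      sum (λ u → 𝟙 (q u) * deg G q u)       ≡⟨ sym handshake ⟩
      2 * cnt (lift G q)                    ∎
      where
      open ≤-Reasoning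
      bound : ∀ u → r * 𝟙 (q u) ≤ 𝟙 (q u) * deg G q u
      bound u with q u in eq
      ... | false = ≤-reflexive (*-zeroʳ r)
      ... | true  = ≤-trans (≤-reflexive (*-identityʳ r)) (≤-trans (h u eq) (≤-reflexive (sym (+-identityʳ _))))

    -- Inside the subgraph induced by `q`, the edge e = uv meets deg u - 1 edges at u and deg v - 1
    -- at v, and no other edge joins u and v. The proof sums an inclusion-exclusion identity over
    -- ordered pairs of adjacent vertices, hence the factor 2; the sum of `K` counts e as well,
    -- which `remove-self` accounts for.
    deg-lift : ∀ e → lift G q e ≡ true →
      deg (L G) (lift G q) e + 2 ≡ deg G q (proj₁ (ends G e)) + deg G q (proj₂ (ends G e))
    deg-lift e le = *-cancelˡ-≡ _ _ 2 (begin
      2 * (deg (L G) (lift G q) e + 2)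
        ≡⟨ solve 1 (λ d → con 2 :* (d :+ con 2) := con 2 :* (con 1 :+ d) :+ (con 1 :+ con 1)) refl (deg (L G) (lift G q) e) ⟩
      2 * (1 + deg (L G) (lift G q) e) + (1 + 1)
        ≡⟨ cong (λ z → 2 * z + (1 + 1)) remove-self ⟩
      2 * sum (λ f → K (ends G f)) + (1 + 1)
        -- The two units are the ordered pairs (u , v) and (v , u), the only ones that meet both
        -- ends of e and so are counted twice on the other side.
        ≡⟨ cong₂ _+_ (sum-edges K K-sym)
             (cong₂ _+_ (trans (sym (cong 𝟙 (∧-true⁺ auv (∧-true⁺ qu qv)))) (sym (∑∑-δδ u v)))
                        (trans (sym (cong 𝟙 (∧-true⁺ (trans (adj-sym v u) auv) (∧-true⁺ qv qu)))) (sym (∑∑-δδ v u)))) ⟩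
      ∑∑ (λ x y → 𝟙 (adj G x y) * K (x , y))
        + (∑∑ (λ x y → W x y * (δ u x * δ v y)) + ∑∑ (λ x y → W x y * (δ v x * δ u y)))
        ≡⟨ sym (trans (∑∑-+ (λ x y → 𝟙 (adj G x y) * K (x , y)) (λ x y → W x y * (δ u x * δ v y) + W x y * (δ v x * δ u y)))
              (cong (∑∑ (λ x y → 𝟙 (adj G x y) * K (x , y)) +_) (∑∑-+ (λ x y → W x y * (δ u x * δ v y)) (λ x y → W x y * (δ v x * δ u y))))) ⟩
      ∑∑ (λ x y → 𝟙 (adj G x y) * K (x , y) + (W x y * (δ u x * δ v y) + W x y * (δ v x * δ u y)))
        ≡⟨ (sum-cong-≗ λ x → sum-cong-≗ λ y → pointwise x y) ⟩
      ∑∑ (λ x y → (W x y * δ u x + W x y * δ u y) + (W x y * δ v x + W x y * δ v y))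
        ≡⟨ trans (∑∑-+ (λ x y → W x y * δ u x + W x y * δ u y) (λ x y → W x y * δ v x + W x y * δ v y))
             (cong₂ _+_ (∑∑-+ (λ x y → W x y * δ u x) (λ x y → W x y * δ u y)) (∑∑-+ (λ x y → W x y * δ v x) (λ x y → W x y * δ v y))) ⟩
      (∑∑ (λ x y → W x y * δ u x) + ∑∑ (λ x y → W x y * δ u y)) + (∑∑ (λ x y → W x y * δ v x) + ∑∑ (λ x y → W x y * δ v y))
        ≡⟨ cong₂ _+_ (cong₂ _+_ (∑∑-δˡ u qu) (∑∑-δʳ u qu)) (cong₂ _+_ (∑∑-δˡ v qv) (∑∑-δʳ v qv)) ⟩
      (deg G q u + deg G q u) + (deg G q v + deg G q v)
        ≡⟨ solve 2 (λ a b → (a :+ a) :+ (b :+ b) := con 2 :* (a :+ b)) refl (deg G q u) (deg G q v) ⟩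
      2 * (deg G q u + deg G q v) ∎)
      where
      open ≡-Reasoning
      open +-*-Solver
      u = proj₁ (ends G e)
      v = proj₂ (ends G e)
      auv = ends-adj G e
      qu : q u ≡ true
      qu = proj₁ (∧-true⁻ le)
      qv : q v ≡ true
      qv = proj₂ (∧-true⁻ {q u} le)
      ∑∑ : (V → V → ℕ) → ℕ
      ∑∑ F = sum (λ x → sum (λ y → F x y))
      ∑∑-+ : ∀ F H → ∑∑ (λ x y → F x y + H x y) ≡ ∑∑ F + ∑∑ H
      ∑∑-+ F H = trans (sum-cong-≗ (λ x → ∑-distrib-+ (F x) (H x))) (∑-distrib-+ (λ x → sum (F x)) (λ x → sum (H x)))
      δ : V → V → ℕ
      δ x y = 𝟙 (x ==F y)
      K : V × V → ℕ
      K (x , y) = 𝟙 (shareEnd (u , v) (x , y)) * 𝟙 (q x ∧ q y)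
      K-sym : ∀ x y → K (x , y) ≡ K (y , x)
      K-sym x y = cong₂ (λ a b → 𝟙 a * 𝟙 b)
        (trans (shareEnd-sym (u , v) (x , y)) (trans (swap (x ==F u) (x ==F v) (y ==F u) (y ==F v)) (shareEnd-sym (y , x) (u , v))))
        (∧-comm (q x) (q y))
        where
        swap : ∀ a b c d → (a ∨ b ∨ c ∨ d) ≡ (c ∨ d ∨ a ∨ b)
        swap true  b     true  d     = refl
        swap true  b     false true  = refl
        swap true  b     false false = refl
        swap false true  true  d     = refl
        swap false true  false true  = refl
        swap false true  false false = refl
        swap false false true  d     = refl
        swap false false false true  = refl
        swap false false false false = refl
      W : V → V → ℕ
      W x y = 𝟙 (adj G x y ∧ (q x ∧ q y))
      remove-self : 1 + deg (L G) (lift G q) e ≡ sum (λ f → K (ends G f))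
      remove-self = begin
        1 + deg (L G) (lift G q) e
          ≡⟨ cong (_+ deg (L G) (lift G q) e) (sym (trans (sum-δ e (λ f → K (ends G f))) K-self)) ⟩
        sum (λ f → 𝟙 (e ==F f) * K (ends G f)) + deg (L G) (lift G q) e
          ≡⟨ sym (∑-distrib-+ (λ f → 𝟙 (e ==F f) * K (ends G f)) _) ⟩
        sum (λ f → 𝟙 (e ==F f) * K (ends G f) + 𝟙 (not (e ==F f) ∧ shareEnd (u , v) (ends G f)) * 𝟙 (lift G q f))
          ≡⟨ sum-cong-≗ (λ f → split (e ==F f) (shareEnd (u , v) (ends G f)) (𝟙 (lift G q f))) ⟩
        _ ∎
        where
        K-self : K (u , v) ≡ 1
        K-self = cong₂ (λ a b → 𝟙 a * 𝟙 b) (∨-true⁺ˡ _ (==F-refl u)) le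
        split : ∀ a b c → 𝟙 a * (𝟙 b * c) + 𝟙 (not a ∧ b) * c ≡ 𝟙 b * c
        split true  b c = trans (+-identityʳ _) (+-identityʳ _)
        split false b c = refl
      ∑∑-δδ : ∀ s t → ∑∑ (λ x y → W x y * (δ s x * δ t y)) ≡ W s t
      ∑∑-δδ s t = trans (sum-cong-≗ (λ x → trans (sum-cong-≗ (λ y →
          solve 3 (λ w a b → w :* (a :* b) := b :* (a :* w)) refl (W x y) (δ s x) (δ t y))) (sum-δ t _)))
        (sum-δ s _)
      ∑∑-δˡ : ∀ s → q s ≡ true → ∑∑ (λ x y → W x y * δ s x) ≡ deg G q s
      ∑∑-δˡ s qs = begin
        ∑∑ (λ x y → W x y * δ s x)
          ≡⟨ sum-cong-≗ (λ x → trans (sum-cong-≗ (λ y → *-comm (W x y) (δ s x))) (sym (*-distribˡ-sum (δ s x) (W x)))) ⟩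
        sum (λ x → δ s x * sum (λ y → W x y))
          ≡⟨ sum-δ s _ ⟩
        sum (λ y → W s y)
          ≡⟨ sum-cong-≗ (λ y → trans (cong (λ b → 𝟙 (adj G s y ∧ (b ∧ q y))) qs) (𝟙-∧ (adj G s y) (q y))) ⟩
        deg G q s ∎
      W-sym : ∀ x y → W x y ≡ W y x
      W-sym x y = cong₂ (λ a b → 𝟙 (a ∧ b)) (adj-sym x y) (∧-comm (q x) (q y))
      ∑∑-δʳ : ∀ s → q s ≡ true → ∑∑ (λ x y → W x y * δ s y) ≡ deg G q s
      ∑∑-δʳ s qs = trans (∑-comm (λ x y → W x y * δ s y))
        (trans (sum-cong-≗ λ y → sum-cong-≗ λ x → cong (_* δ s y) (W-sym x y)) (∑∑-δˡ s qs))
      -- Inclusion-exclusion for the events u = x, u = y, v = x, v = y. As x ≠ y and u ≠ v, only the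
      -- first and last, or the middle two, can hold together.
      bool : ∀ a b c d → (a ≡ true → b ≡ true → ⊥) → (c ≡ true → d ≡ true → ⊥) →
        (a ≡ true → c ≡ true → ⊥) → (b ≡ true → d ≡ true → ⊥) →
        𝟙 (a ∨ b ∨ c ∨ d) + (𝟙 a * 𝟙 d + 𝟙 c * 𝟙 b) ≡ (𝟙 a + 𝟙 b) + (𝟙 c + 𝟙 d)
      bool true  true  c     d     ab cd ac bd = ⊥-elim (ab refl refl)
      bool true  false true  d     ab cd ac bd = ⊥-elim (ac refl refl)
      bool true  false false true  ab cd ac bd = refl
      bool true  false false false ab cd ac bd = refl
      bool false true  true  true  ab cd ac bd = ⊥-elim (cd refl refl)
      bool false true  true  false ab cd ac bd = refl
      bool false true  false true  ab cd ac bd = ⊥-elim (bd refl refl)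
      bool false true  false false ab cd ac bd = refl
      bool false false true  true  ab cd ac bd = ⊥-elim (cd refl refl)
      bool false false true  false ab cd ac bd = refl
      bool false false false true  ab cd ac bd = refl
      bool false false false false ab cd ac bd = refl
      pointwise : ∀ x y → 𝟙 (adj G x y) * K (x , y) + (W x y * (δ u x * δ v y) + W x y * (δ v x * δ u y))
        ≡ (W x y * δ u x + W x y * δ u y) + (W x y * δ v x + W x y * δ v y)
      pointwise x y with adj G x y in axy
      ... | false = refl
      ... | true  = begin
        1 * (𝟙 s * w) + (w * (a * d) + w * (c * b))
          ≡⟨ solve 6 (λ s w a b c d → con 1 :* (s :* w) :+ (w :* (a :* d) :+ w :* (c :* b)) := w :* (s :+ (a :* d :+ c :* b)))
               refl (𝟙 s) w a b c d ⟩
        w * (𝟙 s + (a * d + c * b))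
          ≡⟨ cong (w *_) (bool (u ==F x) (u ==F y) (v ==F x) (v ==F y)
               (λ p r → adj⇒≢ axy (trans (sym (==F-true⁻ {i = u} {x} p)) (==F-true⁻ {i = u} {y} r)))
               (λ p r → adj⇒≢ axy (trans (sym (==F-true⁻ {i = v} {x} p)) (==F-true⁻ {i = v} {y} r)))
               (λ p r → ends-≢ G e (trans (==F-true⁻ {i = u} {x} p) (sym (==F-true⁻ {i = v} {x} r))))
               (λ p r → ends-≢ G e (trans (==F-true⁻ {i = u} {y} p) (sym (==F-true⁻ {i = v} {y} r))))) ⟩
        w * ((a + b) + (c + d))
          ≡⟨ solve 5 (λ w a b c d → w :* ((a :+ b) :+ (c :+ d)) := (w :* a :+ w :* b) :+ (w :* c :+ w :* d)) refl w a b c d ⟩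
        _ ∎
        where
        s = shareEnd (u , v) (x , y)
        w = 𝟙 (q x ∧ q y)
        a = δ u x
        b = δ u y
        c = δ v x
        d = δ v y

    -- Dropping the -2 keeps the bound a pure doubling, parallel to `deg-lift-≥`, where it is the
    -- excess over 2 that doubles. The loss is made up for by the constants in `leaves`.
    deg-lift-≤ : ∀ r → (∀ u → q u ≡ true → deg G q u ≤ r) →
      ∀ e → lift G q e ≡ true → deg (L G) (lift G q) e ≤ 2 * r
    deg-lift-≤ r h e le = begin
      deg (L G) (lift G q) e      ≤⟨ m≤m+n _ 2 ⟩
      deg (L G) (lift G q) e + 2  ≡⟨ deg-lift e le ⟩
      _                           ≤⟨ +-mono-≤ (h _ (proj₁ (∧-true⁻ le))) (h _ (proj₂ (∧-true⁻ {q (proj₁ (ends G e))} le))) ⟩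
      r + r                       ≡⟨ cong (r +_) (sym (+-identityʳ r)) ⟩
      2 * r ∎
      where open ≤-Reasoning

    deg-lift-≥ : ∀ r → (∀ u → q u ≡ true → r + 2 ≤ deg G q u) →
      ∀ e → lift G q e ≡ true → 2 * r + 2 ≤ deg (L G) (lift G q) e
    deg-lift-≥ r h e le = +-cancelʳ-≤ 2 _ _ (begin
      2 * r + 2 + 2               ≡⟨ solve 1 (λ r → con 2 :* r :+ con 2 :+ con 2 := (r :+ con 2) :+ (r :+ con 2)) refl r ⟩
      (r + 2) + (r + 2)           ≤⟨ +-mono-≤ (h _ (proj₁ (∧-true⁻ le))) (h _ (proj₂ (∧-true⁻ {q (proj₁ (ends G e))} le))) ⟩
      _                           ≡⟨ sym (deg-lift e le) ⟩
      deg (L G) (lift G q) e + 2  ∎)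
      where
      open ≤-Reasoning
      open +-*-Solver

-- Adjacency of edges through a common end

infix 4 _∈ₑ_
_∈ₑ_ : ∀ {n} → Fin n → Fin n × Fin n → Set
z ∈ₑ (u , v) = z ≡ u ⊎ z ≡ v

shareEnd⁻ : ∀ {n} (e f : Fin n × Fin n) → shareEnd e f ≡ true → ∃ λ z → z ∈ₑ e × z ∈ₑ f
shareEnd⁻ (u , v) (x , y) s with ∨-true⁻ {u ==F x} s
... | inj₁ p = u , inj₁ refl , inj₁ (==F-true⁻ {i = u} {x} p)
... | inj₂ s′ with ∨-true⁻ {u ==F y} s′
...   | inj₁ p = u , inj₁ refl , inj₂ (==F-true⁻ {i = u} {y} p)
...   | inj₂ s″ with ∨-true⁻ {v ==F x} s″
...     | inj₁ p = v , inj₂ refl , inj₁ (==F-true⁻ {i = v} {x} p)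
...     | inj₂ p = v , inj₂ refl , inj₂ (==F-true⁻ {i = v} {y} p)

shareEnd⁺ : ∀ {n} (e f : Fin n × Fin n) {z} → z ∈ₑ e → z ∈ₑ f → shareEnd e f ≡ true
shareEnd⁺ (u , v) (x , y) (inj₁ refl) (inj₁ refl) = ∨-true⁺ˡ _ (==F-refl u)
shareEnd⁺ (u , v) (x , y) (inj₁ refl) (inj₂ refl) = ∨-true⁺ʳ (u ==F x) (∨-true⁺ˡ _ (==F-refl u))
shareEnd⁺ (u , v) (x , y) (inj₂ refl) (inj₁ refl) = ∨-true⁺ʳ (u ==F x) (∨-true⁺ʳ (u ==F y) (∨-true⁺ˡ _ (==F-refl v)))
shareEnd⁺ (u , v) (x , y) (inj₂ refl) (inj₂ refl) = ∨-true⁺ʳ (u ==F x) (∨-true⁺ʳ (u ==F y) (∨-true⁺ʳ (v ==F x) (==F-refl v)))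

L-adj⁻ : ∀ G {e f} → adj (L G) e f ≡ true → e ≢ f × ∃ λ z → z ∈ₑ ends G e × z ∈ₑ ends G f
L-adj⁻ G {e} {f} a =
  (λ e≡f → adj⇒≢ (L-simple G) a e≡f) ,
  shareEnd⁻ (ends G e) (ends G f) (proj₂ (∧-true⁻ {not (e ==F f)} a))

L-adj⁺ : ∀ G {e f z} → e ≢ f → z ∈ₑ ends G e → z ∈ₑ ends G f → adj (L G) e f ≡ true
L-adj⁺ G {e} {f} e≢f ze zf = ∧-true⁺ (cong not (==F-false e≢f)) (shareEnd⁺ (ends G e) (ends G f) ze zf)

-- Disjointness and locality

cnt-disjoint : ∀ {n} (q q′ : Fin n → Bool) → (∀ u → q u ≡ true → q′ u ≡ true → ⊥) → cnt q + cnt q′ ≤ n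
cnt-disjoint {n} q q′ disj = begin
  cnt q + cnt q′                     ≡⟨ sym (∑-distrib-+ (λ u → 𝟙 (q u)) (λ u → 𝟙 (q′ u))) ⟩
  sum (λ u → 𝟙 (q u) + 𝟙 (q′ u))     ≤⟨ sum-mono-≤ (λ u → bound (q u) (q′ u) (disj u)) ⟩
  sum {n} (λ _ → 1)                  ≡⟨ cnt-all n ⟩
  n                                  ∎
  where
  open ≤-Reasoning
  bound : ∀ a b → (a ≡ true → b ≡ true → ⊥) → 𝟙 a + 𝟙 b ≤ 1
  bound true  true  h = ⊥-elim (h refl refl)
  bound true  false h = ≤-refl
  bound false b     h = 𝟙≤1 b

cnt-cover : ∀ {n} (q q′ : Fin n → Bool) → (∀ u → q u ≡ true ⊎ q′ u ≡ true) → n ≤ cnt q + cnt q′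
cnt-cover {n} q q′ cover = begin
  n                                  ≡⟨ sym (cnt-all n) ⟩
  sum {n} (λ _ → 1)                  ≤⟨ sum-mono-≤ (λ u → bound (q u) (q′ u) (cover u)) ⟩
  sum (λ u → 𝟙 (q u) + 𝟙 (q′ u))     ≡⟨ ∑-distrib-+ (λ u → 𝟙 (q u)) (λ u → 𝟙 (q′ u)) ⟩
  cnt q + cnt q′                     ∎
  where
  open ≤-Reasoning
  bound : ∀ a b → a ≡ true ⊎ b ≡ true → 1 ≤ 𝟙 a + 𝟙 b
  bound true b _        = s≤s z≤n
  bound false true (inj₂ _) = ≤-refl

liftIter-disjoint : ∀ G (q q′ : Fin (size G) → Bool) → (∀ u → q u ≡ true → q′ u ≡ true → ⊥) →
  ∀ j t → liftIter G j q t ≡ true → liftIter G j q′ t ≡ true → ⊥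
liftIter-disjoint G q q′ disj zero    t p r = disj t p r
liftIter-disjoint G q q′ disj (suc j) t p r =
  liftIter-disjoint G q q′ disj j _ (proj₁ (∧-true⁻ p)) (proj₁ (∧-true⁻ r))

-- b r stands for the r-neighbourhood of the complement of q.
record Exhaustion (G : Graph) (q : Fin (size G) → Bool) (b : ℕ → Fin (size G) → Bool) (m : ℕ) : Set where
  field
    start  : ∀ u → q u ≡ true ⊎ b 0 u ≡ true
    grow   : ∀ r → r < m → ∀ u → b r u ≡ true → b (suc r) u ≡ true
    spread : ∀ r → r < m → ∀ u w → adj G u w ≡ true → b r u ≡ true → b (suc r) w ≡ true

open Exhaustion

-- An edge that touches `b r` lies entirely in `b (suc r)`. Hence the radius shifts by one at each
-- level, and one unit of the guaranteed depth is used up.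
lift-exhaustion : ∀ {G q b m} → IsSimple G → Exhaustion G q b (suc m) →
  Exhaustion (L G) (lift G q) (λ r → lift G (b (suc r))) m
lift-exhaustion {G} {q} {b} {m} simple E = record { start = start′ ; grow = grow′ ; spread = spread′ }
  where
  absorb : ∀ r → r < suc m → ∀ {z} f → z ∈ₑ ends G f → b r z ≡ true → lift G (b (suc r)) f ≡ true
  absorb r r<m f (inj₁ refl) bz = ∧-true⁺ (grow E r r<m _ bz) (spread E r r<m _ _ (ends-adj G f) bz)
  absorb r r<m f (inj₂ refl) bz =
    ∧-true⁺ (spread E r r<m _ _ (trans (proj₁ simple _ _) (ends-adj G f)) bz) (grow E r r<m _ bz)
  start′ : ∀ e → lift G q e ≡ true ⊎ lift G (b 1) e ≡ true
  start′ e with start E (proj₁ (ends G e)) | start E (proj₂ (ends G e))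
  ... | inj₁ p | inj₁ p′ = inj₁ (∧-true⁺ p p′)
  ... | inj₂ p | _       = inj₂ (absorb 0 (s≤s z≤n) e (inj₁ refl) p)
  ... | _      | inj₂ p  = inj₂ (absorb 0 (s≤s z≤n) e (inj₂ refl) p)
  grow′ : ∀ r → r < m → ∀ e → lift G (b (suc r)) e ≡ true → lift G (b (suc (suc r))) e ≡ true
  grow′ r r<m e p = absorb (suc r) (s≤s r<m) e (inj₁ refl) (proj₁ (∧-true⁻ p))
  spread′ : ∀ r → r < m → ∀ e f → adj (L G) e f ≡ true → lift G (b (suc r)) e ≡ true → lift G (b (suc (suc r))) f ≡ true
  spread′ r r<m e f a p with proj₂ (L-adj⁻ G {e} {f} a)
  ... | z , inj₁ refl , zf = absorb (suc r) (s≤s r<m) f zf (proj₁ (∧-true⁻ p))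
  ... | z , inj₂ refl , zf = absorb (suc r) (s≤s r<m) f zf (proj₂ (∧-true⁻ {b (suc r) (proj₁ (ends G e))} p))

module _ {G : Graph} (simple : IsSimple G) {q : Fin (size G) → Bool} {b : ℕ → Fin (size G) → Bool} where

  private
    -- Radius r at level j is radius r + j in the original graph. The recursion follows the shift in
    -- `lift-exhaustion` definitionally; `shifted≡` converts it into the closed form.
    shifted : ∀ j → ℕ → Fin (size (Liter j G)) → Bool
    shifted zero    r = b r
    shifted (suc j) r = lift (Liter j G) (shifted j (suc r))

    shifted≡ : ∀ j r → shifted j r ≡ liftIter G j (b (r + j))
    shifted≡ zero    r = cong b (sym (+-identityʳ r))
    shifted≡ (suc j) r = trans (cong (lift (Liter j G)) (shifted≡ j (suc r)))
      (cong (λ k → lift (Liter j G) (liftIter G j (b k))) (sym (+-suc r j)))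

    exhaustionIter : ∀ j m → Exhaustion G q b (j + m) → Exhaustion (Liter j G) (liftIter G j q) (shifted j) m
    exhaustionIter zero    m E = E
    exhaustionIter (suc j) m E = lift-exhaustion (Liter-simple simple j)
      (exhaustionIter j (suc m) (subst (Exhaustion G q b) (sym (+-suc j m)) E))

  liftIter-cover : ∀ j → Exhaustion G q b j → ∀ t → liftIter G j q t ≡ true ⊎ liftIter G j (b j) t ≡ true
  liftIter-cover j E t =
    subst (λ h → liftIter G j q t ≡ true ⊎ h t ≡ true) (shifted≡ j 0)
      (start (exhaustionIter j 0 (subst (Exhaustion G q b) (sym (+-identityʳ j)) E)) t)

-- Partial embeddings

-- Even where `G` and `H` agree, their edge lists may number the common edges differently, so from
-- the first line graph on corresponding vertices have different indices. A relation lifts by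
-- comparing ends alone; `total` then supplies the images, and keeps them inside `q′`.
record PartialEmbedding (G H : Graph) (q : Fin (size G) → Bool) (q′ : Fin (size H) → Bool)
                        (R : Fin (size G) → Fin (size H) → Set) : Set where
  field
    total      : ∀ u → q u ≡ true → ∃ λ x → R u x × q′ x ≡ true
    functional : ∀ {u x y} → R u x → R u y → x ≡ y
    injective  : ∀ {u v x} → R u x → R v x → u ≡ v
    preserves  : ∀ {u v x y} → q u ≡ true → q v ≡ true → R u x → R v y → adj G u v ≡ true → adj H x y ≡ true

open PartialEmbedding

-- Ends are stored in increasing order, which a correspondence of vertices may reverse; hence the
-- second alternative.
liftRel : ∀ G H → (Fin (size G) → Fin (size H) → Set) → Fin (size (L G)) → Fin (size (L H)) → Set
liftRel G H R e f =
  let u , v = ends G e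
      x , y = ends H f
  in (R u x × R v y) ⊎ (R u y × R v x)

lift-embedding : ∀ {G H q q′ R} → IsSimple H → PartialEmbedding G H q q′ R →
  PartialEmbedding (L G) (L H) (lift G q) (lift H q′) (liftRel G H R)
lift-embedding {G} {H} {q} {q′} {R} simple E =
  record { total = total′ ; functional = λ {e} → functional′ {e} ; injective = λ {e} → injective′ {e}
         ; preserves = λ {e} {e′} {f} {f′} → preserves′ {e} {e′} {f} {f′} }
  where
  RL = liftRel G H R
  total′ : ∀ e → lift G q e ≡ true → ∃ λ f → RL e f × lift H q′ f ≡ true
  total′ e le with ∧-true⁻ {q (proj₁ (ends G e))} le
  ... | qu , qv with total E _ qu | total E _ qv
  ... | x , Rux , qx | y , Rvy , qy with preserves E qu qv Rux Rvy (ends-adj G e)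
  ... | axy with <-cmp (toℕ x) (toℕ y)
  ... | tri≈ _ x≡y _ = ⊥-elim (adj⇒≢ simple axy (Fin.toℕ-injective x≡y))
  ... | tri< x<y _ _ with ends-surjective H x<y axy
  ...   | f , eq = f , subst (λ (s , t) → (R u s × R v t) ⊎ (R u t × R v s)) (sym eq) (inj₁ (Rux , Rvy))
                     , subst (λ (s , t) → (q′ s ∧ q′ t) ≡ true) (sym eq) (∧-true⁺ qx qy)
    where
    u = proj₁ (ends G e)
    v = proj₂ (ends G e)
  total′ e le | qu , qv | x , Rux , qx | y , Rvy , qy | axy | tri> _ _ y<x
    with ends-surjective H y<x (trans (proj₁ simple y x) axy)
  ...   | f , eq = f , subst (λ (s , t) → (R u s × R v t) ⊎ (R u t × R v s)) (sym eq) (inj₂ (Rux , Rvy))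
                     , subst (λ (s , t) → (q′ s ∧ q′ t) ≡ true) (sym eq) (∧-true⁺ qy qx)
    where
    u = proj₁ (ends G e)
    v = proj₂ (ends G e)
  crossed : ∀ K {e f} → proj₁ (ends K e) ≡ proj₂ (ends K f) → proj₂ (ends K e) ≡ proj₁ (ends K f) → ⊥
  crossed K {e} {f} p r = <-asym (ends-< K e) (subst₂ _<_ (cong toℕ (sym r)) (cong toℕ (sym p)) (ends-< K f))
  functional′ : ∀ {e f f′} → RL e f → RL e f′ → f ≡ f′
  functional′ (inj₁ (a , b)) (inj₁ (c , d)) = ends-injective H (cong₂ _,_ (functional E a c) (functional E b d))
  functional′ (inj₂ (a , b)) (inj₂ (c , d)) = ends-injective H (cong₂ _,_ (functional E b d) (functional E a c))
  functional′ {f = f} {f′} (inj₁ (a , b)) (inj₂ (c , d)) = ⊥-elim (crossed H {f} {f′} (functional E a c) (functional E b d))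
  functional′ {f = f} {f′} (inj₂ (a , b)) (inj₁ (c , d)) = ⊥-elim (crossed H {f} {f′} (functional E b d) (functional E a c))
  injective′ : ∀ {e e′ f} → RL e f → RL e′ f → e ≡ e′
  injective′ (inj₁ (a , b)) (inj₁ (c , d)) = ends-injective G (cong₂ _,_ (injective E a c) (injective E b d))
  injective′ (inj₂ (a , b)) (inj₂ (c , d)) = ends-injective G (cong₂ _,_ (injective E a c) (injective E b d))
  injective′ {e} {e′} (inj₁ (a , b)) (inj₂ (c , d)) = ⊥-elim (crossed G {e} {e′} (injective E a d) (injective E b c))
  injective′ {e} {e′} (inj₂ (a , b)) (inj₁ (c , d)) = ⊥-elim (crossed G {e} {e′} (injective E a d) (injective E b c))
  follow : ∀ {e f z} → RL e f → z ∈ₑ ends G e → ∃ λ x → x ∈ₑ ends H f × R z x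
  follow (inj₁ (a , b)) (inj₁ refl) = _ , inj₁ refl , a
  follow (inj₁ (a , b)) (inj₂ refl) = _ , inj₂ refl , b
  follow (inj₂ (a , b)) (inj₁ refl) = _ , inj₂ refl , a
  follow (inj₂ (a , b)) (inj₂ refl) = _ , inj₁ refl , b
  preserves′ : ∀ {e e′ f f′} → lift G q e ≡ true → lift G q e′ ≡ true → RL e f → RL e′ f′ →
    adj (L G) e e′ ≡ true → adj (L H) f f′ ≡ true
  preserves′ {e} {e′} {f} {f′} _ _ r r′ a with L-adj⁻ G {e} {e′} a
  ... | e≢e′ , z , ze , ze′ with follow {e} {f} r ze | follow {e′} {f′} r′ ze′
  ... | x , xf , Rzx | x′ , xf′ , Rzx′ =
    L-adj⁺ H (λ { refl → e≢e′ (injective′ {e} {e′} {f} r r′) }) xf (subst (_∈ₑ ends H f′) (functional E Rzx′ Rzx) xf′)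

liftRelIter : ∀ G H → (Fin (size G) → Fin (size H) → Set) → ∀ j → Fin (size (Liter j G)) → Fin (size (Liter j H)) → Set
liftRelIter G H R zero    = R
liftRelIter G H R (suc j) = liftRel (Liter j G) (Liter j H) (liftRelIter G H R j)

embedding-cnt : ∀ {G H q q′ R} → IsSimple H → PartialEmbedding G H q q′ R →
  ∀ j → cnt (liftIter G j q) ≤ cnt (liftIter H j q′)
embedding-cnt {G} {H} {q} {q′} {R} simple E j =
  cnt-injection (liftIter G j q) (liftIter H j q′)
    (λ t p → proj₁ (total (Eⱼ j) t p)) (λ t p → proj₂ (proj₂ (total (Eⱼ j) t p)))
    (λ t t′ p p′ eq → injective (Eⱼ j) (proj₁ (proj₂ (total (Eⱼ j) t p)))
      (subst (liftRelIter G H R j t′) (sym eq) (proj₁ (proj₂ (total (Eⱼ j) t′ p′)))))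
  where
  Eⱼ : ∀ j → PartialEmbedding (Liter j G) (Liter j H) (liftIter G j q) (liftIter H j q′) (liftRelIter G H R j)
  Eⱼ zero    = E
  Eⱼ (suc j) = lift-embedding (Liter-simple simple j) (Eⱼ j)

-- Growth

module _ {G H : Graph} (simpleG : IsSimple G) (simpleH : IsSimple H)
         (s : Fin (size G) → Bool) (b : Fin (size H) → Bool) (α β : ℕ)
         (deg-s : ∀ e → lift G s e ≡ true → α + 2 ≤ deg (L G) (lift G s) e)
         (deg-b : ∀ e → lift H b e ≡ true → deg (L H) (lift H b) e ≤ β) where

  private
    sₜ : ∀ t → Fin (size (Liter (suc t) G)) → Bool
    sₜ t = liftIter G (suc t) s
    bₜ : ∀ t → Fin (size (Liter (suc t) H)) → Bool
    bₜ t = liftIter H (suc t) b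

    -- The bounds start in the first line graph and not in the tree: there the star has leaves of
    -- degree 1, whereas its line graph is complete. The summand 2 is the fixed point of d ↦ 2 d -
    -- 2.
    deg-sₜ : ∀ t e → sₜ t e ≡ true → 2 ^ t * α + 2 ≤ deg (Liter (suc t) G) (sₜ t) e
    deg-sₜ zero    e p = subst (λ z → z + 2 ≤ deg (L G) (lift G s) e) (sym (+-identityʳ α)) (deg-s e p)
    deg-sₜ (suc t) e p = subst (λ z → z + 2 ≤ deg (Liter (suc (suc t)) G) (sₜ (suc t)) e) (sym (*-assoc 2 (2 ^ t) α))
      (deg-lift-≥ (Liter-simple simpleG (suc t)) (sₜ t) (2 ^ t * α) (deg-sₜ t) e p)

    deg-bₜ : ∀ t e → bₜ t e ≡ true → deg (Liter (suc t) H) (bₜ t) e ≤ 2 ^ t * β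
    deg-bₜ zero    e p = subst (deg (L H) (lift H b) e ≤_) (sym (+-identityʳ β)) (deg-b e p)
    deg-bₜ (suc t) e p = subst (deg (Liter (suc (suc t)) H) (bₜ (suc t)) e ≤_) (sym (*-assoc 2 (2 ^ t) β))
      (deg-lift-≤ (Liter-simple simpleH (suc t)) (bₜ t) (2 ^ t * β) (deg-bₜ t) e p)

  -- As all degrees are at least 2, the number of edges is at least the number of vertices at every
  -- level.
  growth-positive : 1 ≤ cnt (lift G s) → ∀ t → 1 ≤ cnt (liftIter G (suc t) s)
  growth-positive h zero    = h
  growth-positive h (suc t) = *-cancelˡ-≤ 2 (begin
    2                                    ≤⟨ m≤n+m 2 (2 ^ t * α) ⟩
    2 ^ t * α + 2                        ≡⟨ sym (*-identityˡ _) ⟩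
    1 * (2 ^ t * α + 2)                  ≤⟨ *-monoˡ-≤ (2 ^ t * α + 2) (growth-positive h t) ⟩
    cnt (sₜ t) * (2 ^ t * α + 2)         ≤⟨ handshake-≥ (Liter-simple simpleG (suc t)) (sₜ t) _ (deg-sₜ t) ⟩
    2 * cnt (sₜ (suc t))                 ∎)
    where open ≤-Reasoning

  -- By the handshake lemma one level multiplies the count for `b` by at most 2^t β / 2 and that for
  -- `s` by at least 2^t α / 2. The powers of 2 cancel, so the quotient of the counts gains at most
  -- a factor β / α; the inequality is this with denominators cleared.
  growth-ratio : ∀ N → cnt (lift H b) ≤ N * cnt (lift G s) →
    ∀ t → cnt (liftIter H (suc t) b) * α ^ t ≤ N * cnt (liftIter G (suc t) s) * β ^ t
  growth-ratio N h zero = subst₂ _≤_ (sym (*-identityʳ _)) (sym (*-identityʳ _)) h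
  growth-ratio N h (suc t) = *-cancelˡ-≤ 2 (begin
    2 * (cnt (bₜ (suc t)) * (α * α ^ t))
      ≡⟨ solve 3 (λ c a x → con 2 :* (c :* (a :* x)) := con 2 :* c :* (a :* x)) refl (cnt (bₜ (suc t))) α (α ^ t) ⟩
    2 * cnt (bₜ (suc t)) * (α * α ^ t)
      ≤⟨ *-monoˡ-≤ (α * α ^ t) (handshake-≤ (Liter-simple simpleH (suc t)) (bₜ t) _ (deg-bₜ t)) ⟩
    cnt (bₜ t) * (2 ^ t * β) * (α * α ^ t)
      ≡⟨ solve 5 (λ c p b a x → c :* (p :* b) :* (a :* x) := (c :* x) :* (p :* a :* b)) refl (cnt (bₜ t)) (2 ^ t) β α (α ^ t) ⟩
    cnt (bₜ t) * α ^ t * (2 ^ t * α * β)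
      ≤⟨ *-monoˡ-≤ (2 ^ t * α * β) (growth-ratio N h t) ⟩
    N * cnt (sₜ t) * β ^ t * (2 ^ t * α * β)
      ≡⟨ solve 5 (λ N c x p b → N :* c :* x :* (p :* b) := c :* p :* (N :* (b :* x))) refl N (cnt (sₜ t)) (β ^ t) (2 ^ t * α) β ⟩
    cnt (sₜ t) * (2 ^ t * α) * (N * (β * β ^ t))
      ≤⟨ *-monoˡ-≤ (N * (β * β ^ t)) (≤-trans (*-monoʳ-≤ (cnt (sₜ t)) (m≤m+n (2 ^ t * α) 2))
           (handshake-≥ (Liter-simple simpleG (suc t)) (sₜ t) _ (deg-sₜ t))) ⟩
    2 * cnt (sₜ (suc t)) * (N * (β * β ^ t))
      ≡⟨ solve 3 (λ c N x → con 2 :* c :* (N :* x) := con 2 :* (N :* c :* x)) refl (cnt (sₜ (suc t))) N (β * β ^ t) ⟩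
    2 * (N * cnt (sₜ (suc t)) * (β * β ^ t)) ∎)
    where
    open ≤-Reasoning
    open +-*-Solver

  growth-< : ∀ N → 1 ≤ cnt (lift G s) → cnt (lift H b) ≤ N → ∀ t → N * β ^ t < α ^ t →
    cnt (liftIter H (suc t) b) < cnt (liftIter G (suc t) s)
  growth-< N pos h t gap = *-cancelʳ-< (α ^ t) _ _ (begin-strict
    cnt (bₜ t) * α ^ t          ≤⟨ growth-ratio N (≤-trans h (≤-trans (≤-reflexive (sym (*-identityʳ N))) (*-monoʳ-≤ N pos))) t ⟩
    N * cnt (sₜ t) * β ^ t      ≡⟨ solve 3 (λ N c x → N :* c :* x := c :* (N :* x)) refl N (cnt (sₜ t)) (β ^ t) ⟩
    cnt (sₜ t) * (N * β ^ t)    <⟨ *-monoʳ-< (cnt (sₜ t)) {{>-nonZero (growth-positive pos t)}} gap ⟩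
    cnt (sₜ t) * α ^ t          ∎)
    where
    open ≤-Reasoning
    open +-*-Solver

-- Trees given by parent functions

-- Vertex 0 is the root, and w > 0 is joined to p w; the value p 0 is irrelevant.
parentAdj : (ℕ → ℕ) → ℕ → ℕ → Bool
parentAdj p u w = ((u <ᵇ w) ∧ (p w ≡ᵇ u)) ∨ ((w <ᵇ u) ∧ (p u ≡ᵇ w))

parentTree : ℕ → (ℕ → ℕ) → Graph
parentTree n p = graph n (λ u w → parentAdj p (toℕ u) (toℕ w))

module _ {p : ℕ → ℕ} where

  parentAdj⁻ : ∀ {u w} → parentAdj p u w ≡ true → (u < w × p w ≡ u) ⊎ (w < u × p u ≡ w)
  parentAdj⁻ {u} {w} a with ∨-true⁻ {(u <ᵇ w) ∧ (p w ≡ᵇ u)} a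
  ... | inj₁ h = inj₁ (<ᵇ-true⁻ (proj₁ (∧-true⁻ h)) , ≡ᵇ-true⁻ (proj₂ (∧-true⁻ {u <ᵇ w} h)))
  ... | inj₂ h = inj₂ (<ᵇ-true⁻ (proj₁ (∧-true⁻ h)) , ≡ᵇ-true⁻ (proj₂ (∧-true⁻ {w <ᵇ u} h)))

  parentAdj⁺ : ∀ {u w} → u < w → p w ≡ u → parentAdj p u w ≡ true
  parentAdj⁺ u<w e = ∨-true⁺ˡ _ (∧-true⁺ (<ᵇ-true u<w) (≡ᵇ-true e))

  parentAdj⁺′ : ∀ {u w} → w < u → p u ≡ w → parentAdj p u w ≡ true
  parentAdj⁺′ {u} {w} w<u e = ∨-true⁺ʳ ((u <ᵇ w) ∧ (p w ≡ᵇ u)) (∧-true⁺ (<ᵇ-true w<u) (≡ᵇ-true e))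

  parentTree-simple : ∀ n → IsSimple (parentTree n p)
  parentTree-simple n = (λ u w → ∨-comm ((toℕ u <ᵇ toℕ w) ∧ (p (toℕ w) ≡ᵇ toℕ u)) _) ,
    (λ u → ¬true⇒false (λ a → irrefl (parentAdj⁻ {toℕ u} a)))
    where
    irrefl : ∀ {u} → ¬ ((u < u × p u ≡ u) ⊎ (u < u × p u ≡ u))
    irrefl (inj₁ (h , _)) = <-irrefl refl h
    irrefl (inj₂ (h , _)) = <-irrefl refl h

  module _ (p< : ∀ w → 0 < w → p w < w) (n : ℕ) where

    private
      G = parentTree n p
      V = Fin n

    walk-trans : ∀ {u v w} → Walk G u v → Walk G v w → Walk G u w
    walk-trans here       r = r
    walk-trans (step a l) r = step a (walk-trans l r)

    walk-sym : ∀ {u v} → Walk G u v → Walk G v u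
    walk-sym here = here
    walk-sym (step {u} {w} a l) = walk-trans (walk-sym l) (step (trans (proj₁ (parentTree-simple n) w u) a) here)

    walk-to-root : ∀ (u : V) → ∃ λ r → toℕ r ≡ 0 × Walk G u r
    walk-to-root u = go u (<-wellFounded (toℕ u))
      where
      go : ∀ u → Acc _<_ (toℕ u) → ∃ λ r → toℕ r ≡ 0 × Walk G u r
      go u (acc rec) with toℕ u ≟ 0
      ... | yes u≡0 = u , u≡0 , here
      ... | no u≢0 =
        let pu<u = p< (toℕ u) (n≢0⇒n>0 u≢0)
            w = fromℕ< (<-trans pu<u (Fin.toℕ<n u))
            w≡ = Fin.toℕ-fromℕ< (<-trans pu<u (Fin.toℕ<n u))
            w<u = subst (_< toℕ u) (sym w≡) pu<u
            r , r≡0 , l = go w (rec w<u)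
        in r , r≡0 , step (parentAdj⁺′ w<u (sym w≡)) l

    parentTree-connected : Connected G
    parentTree-connected u v =
      let r , r≡0 , l = walk-to-root u
          r′ , r′≡0 , l′ = walk-to-root v
      in walk-trans l (subst (λ r → Walk G r v) (Fin.toℕ-injective (trans r′≡0 (sym r≡0))) (walk-sym l′))

    NonBacktracking : List V → Set
    NonBacktracking (u ∷ l@(_ ∷ w ∷ _)) = u ≢ w × NonBacktracking l
    NonBacktracking _                   = ⊤

    nonBacktracking-tail : ∀ {x} (u w : V) l → NonBacktracking (u ∷ w ∷ l ++ x ∷ []) → NonBacktracking (w ∷ l ++ x ∷ [])
    nonBacktracking-tail u w []      (_ , nb) = nb
    nonBacktracking-tail u w (_ ∷ l) (_ , nb) = nb

    unique⇒nonBacktracking : ∀ {x} l → Unique l → All (x ≢_) l → NonBacktracking (l ++ x ∷ [])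
    unique⇒nonBacktracking []              _                          _             = tt
    unique⇒nonBacktracking (u ∷ [])        _                          _             = tt
    unique⇒nonBacktracking (u ∷ w ∷ [])    _                          (x≢u ∷ _)     = x≢u ∘ sym , tt
    unique⇒nonBacktracking (u ∷ w ∷ y ∷ l) ((_ ∷ u≢y ∷ _) ∷ uniq)     (_ ∷ fresh)   = u≢y , unique⇒nonBacktracking (w ∷ y ∷ l) uniq fresh

    -- After one step from a parent to a child, a non-backtracking walk can only go on to children.
    descend : ∀ {x} (u w : V) l → toℕ u < toℕ w → p (toℕ w) ≡ toℕ u →
      NonBacktracking (u ∷ w ∷ l ++ x ∷ []) → Chain G (w ∷ l ++ x ∷ []) →
      toℕ u < toℕ x × Any (λ v → p (toℕ x) ≡ toℕ v) (w ∷ l)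
    descend u w [] u<w pw≡u (u≢x , _) (a , _) with parentAdj⁻ {toℕ w} a
    ... | inj₁ (w<x , px≡w) = <-trans u<w w<x , Any.here px≡w
    ... | inj₂ (_   , pw≡x) = ⊥-elim (u≢x (Fin.toℕ-injective (trans (sym pw≡u) pw≡x)))
    descend u w (y ∷ l) u<w pw≡u (u≢y , nb) (a , c) with parentAdj⁻ {toℕ w} a
    ... | inj₂ (_   , pw≡y) = ⊥-elim (u≢y (Fin.toℕ-injective (trans (sym pw≡u) pw≡y)))
    ... | inj₁ (w<y , py≡w) = let w<x , any = descend w y l w<y py≡w nb c in <-trans u<w w<x , Any.there any

    -- A non-backtracking walk climbs and then descends. Either it climbs all the way, and x is
    -- smaller than u, or its last step enters x from the parent of x.
    ascend : ∀ {x} (u : V) l → NonBacktracking (u ∷ l ++ x ∷ []) → Chain G (u ∷ l ++ x ∷ []) →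
      toℕ x < toℕ u ⊎ Any (λ v → p (toℕ x) ≡ toℕ v) (u ∷ l)
    ascend u [] nb (a , _) with parentAdj⁻ {toℕ u} a
    ... | inj₁ (_   , px≡u) = inj₂ (Any.here px≡u)
    ... | inj₂ (x<u , _)    = inj₁ x<u
    ascend u (w ∷ l) nb (a , c) with parentAdj⁻ {toℕ u} a
    ... | inj₁ (u<w , pw≡u) = inj₂ (Any.there (proj₂ (descend u w l u<w pw≡u nb c)))
    ... | inj₂ (w<u , _) with ascend w l (nonBacktracking-tail u w l nb) c
    ...   | inj₁ x<w = inj₁ (<-trans x<w w<u)
    ...   | inj₂ any = inj₂ (Any.there any)

    parent∉ : ∀ {x y : V} {l} → p (toℕ x) ≡ toℕ y → All (y ≢_) l → ¬ Any (λ v → p (toℕ x) ≡ toℕ v) l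
    parent∉ px≡y y∉ any = All¬⇒¬Any y∉ (Any.map (λ e → Fin.toℕ-injective (trans (sym px≡y) e)) any)

    parentTree-acyclic : ¬ HasCycle G
    parentTree-acyclic (x , y , z , rest , (x≢y ∷ x≢z ∷ x∉) ∷ uniq@(y∉ ∷ uniq′) , a , c@(b , d))
      with parentAdj⁻ {toℕ x} a
    ... | inj₁ (x<y , py≡x) = <-irrefl refl (proj₁ (descend x y (z ∷ rest) x<y py≡x
            (x≢z , unique⇒nonBacktracking (y ∷ z ∷ rest) uniq (x≢y ∷ x≢z ∷ x∉)) c))
    -- Now y is the parent of x and does not occur again on the cycle, so the last step cannot enter
    -- x from its parent. The only alternative, climbing all the way from x back to x, contradicts
    -- the numbering.
    ... | inj₂ (y<x , px≡y) with parentAdj⁻ {toℕ y} b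
    ...   | inj₁ (y<z , pz≡y) = parent∉ px≡y y∉ (proj₂ (descend y z rest y<z pz≡y
              (unique⇒nonBacktracking (y ∷ z ∷ rest) uniq (x≢y ∷ x≢z ∷ x∉)) d))
    ...   | inj₂ (z<y , _) with ascend z rest (unique⇒nonBacktracking (z ∷ rest) uniq′ (x≢z ∷ x∉)) d
    ...     | inj₁ x<z = <-asym x<z (<-trans z<y y<x)
    ...     | inj₂ any = parent∉ px≡y y∉ any

    parentTree-isTree : IsTree G
    parentTree-isTree = parentTree-simple n , parentTree-connected , parentTree-acyclic

-- The children in `b` are bounded by an interval, since the leaves of a star are consecutive. The
-- truncated difference w ∸ u is positive on children and sends the parent to the free value 0.
parentTree-deg-≤ : ∀ {n p} (b : Fin n → Bool) (u : Fin n) A →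
  (∀ w → b w ≡ true → toℕ u < toℕ w → p (toℕ w) ≡ toℕ u → toℕ w ≤ toℕ u + A) →
  deg (parentTree n p) b u ≤ suc A
parentTree-deg-≤ {n} {p} b u A children = begin
  deg (parentTree n p) b u   ≡⟨ sum-cong-≗ (λ w → sym (𝟙-∧ (parentAdj p (toℕ u) (toℕ w)) (b w))) ⟩
  cnt nbr                    ≤⟨ cnt-injection nbr (λ _ → true) f (λ _ _ → refl) f-injective ⟩
  cnt {suc A} (λ _ → true)   ≡⟨ cnt-all (suc A) ⟩
  suc A                      ∎
  where
  open ≤-Reasoning
  nbr : Fin n → Bool
  nbr w = parentAdj p (toℕ u) (toℕ w) ∧ b w
  nbr⁻ : ∀ w → nbr w ≡ true → (toℕ u < toℕ w × toℕ w ≤ toℕ u + A) ⊎ (toℕ w < toℕ u × p (toℕ u) ≡ toℕ w)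
  nbr⁻ w h with ∧-true⁻ {parentAdj p (toℕ u) (toℕ w)} h
  ... | a , bw with parentAdj⁻ {p} {toℕ u} a
  ...   | inj₁ (u<w , pw≡u) = inj₁ (u<w , children w bw u<w pw≡u)
  ...   | inj₂ up           = inj₂ up
  bound : ∀ w → nbr w ≡ true → toℕ w ∸ toℕ u < suc A
  bound w h with nbr⁻ w h
  ... | inj₁ (_ , w≤)   = s≤s (m≤n+o⇒m∸n≤o (toℕ w) (toℕ u) w≤)
  ... | inj₂ (w<u , _)  = subst (_< suc A) (sym (m≤n⇒m∸n≡0 (<⇒≤ w<u))) (s≤s z≤n)
  f : ∀ w → nbr w ≡ true → Fin (suc A)
  f w h = fromℕ< (bound w h)
  f-injective : ∀ w v h k → f w h ≡ f v k → w ≡ v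
  f-injective w v h k eq with nbr⁻ w h | nbr⁻ v k | Fin.fromℕ<-injective _ _ (bound w h) (bound v k) eq
  ... | inj₁ (u<w , _) | inj₁ (u<v , _) | e = Fin.toℕ-injective (∸-cancelʳ-≡ (<⇒≤ u<w) (<⇒≤ u<v) e)
  ... | inj₁ (u<w , _) | inj₂ (v<u , _) | e = ⊥-elim (<⇒≢ (m<n⇒0<n∸m u<w) (sym (trans e (m≤n⇒m∸n≡0 (<⇒≤ v<u)))))
  ... | inj₂ (w<u , _) | inj₁ (u<v , _) | e = ⊥-elim (<⇒≢ (m<n⇒0<n∸m u<v) (trans (sym (m≤n⇒m∸n≡0 (<⇒≤ w<u))) e))
  ... | inj₂ (_ , pw)  | inj₂ (_ , pv)  | _ = Fin.toℕ-injective (trans (sym pw) pv)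

-- The star trees

-- An edge of star i has degree at least `leaves i` - 1 in the line graph, an excess α = `leaves i`
-- - 3 over 2. The competing bound β is 2 on a bare path and one more than the number of leaves at
-- the largest smaller star. So β < α forces 6 leaves at i = 0 and a step of at least 5, which gives
-- β = 5 i + 2 and α = β + 1.
leaves : ℕ → ℕ
leaves i = 5 * i + 6

module _ (Q : ℕ) .{{_ : NonZero Q}} where

  -- Block i consists of the vertices i Q, …, (i + 1) Q − 1; its star, if any, is centred at i Q,
  -- and the path continues from its last leaf.
  starLeaf : (ℕ → Bool) → ℕ → Bool
  starLeaf x w = (0 <ᵇ w % Q) ∧ (w % Q <ᵇ suc (leaves (w / Q))) ∧ x (w / Q)

  parent : (ℕ → Bool) → ℕ → ℕ
  parent x w = if starLeaf x w then (w / Q) * Q else w ∸ 1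

  decompose : ∀ w → w ≡ w % Q + (w / Q) * Q
  decompose w = m≡m%n+[m/n]*n w Q

  block-≤ : ∀ w → (w / Q) * Q ≤ w
  block-≤ w = subst ((w / Q) * Q ≤_) (sym (decompose w)) (m≤n+m _ _)

  block-< : ∀ w → w < suc (w / Q) * Q
  block-< w = subst (_< suc (w / Q) * Q) (sym (decompose w)) (+-monoˡ-< ((w / Q) * Q) (m%n<n w Q))

  block-mono : ∀ {i w} → i * Q ≤ w → i ≤ w / Q
  block-mono {i} {w} h = s≤s⁻¹ (*-cancelʳ-< Q i (suc (w / Q)) (≤-<-trans h (block-< w)))

  block-mono′ : ∀ {i w} → w < suc i * Q → w / Q ≤ i
  block-mono′ {i} {w} h = s≤s⁻¹ (*-cancelʳ-< Q (w / Q) (suc i) (≤-<-trans (block-≤ w) h))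

  data ParentView (x : ℕ → Bool) (w : ℕ) : Set where
    path : parent x w ≡ w ∸ 1 → ParentView x w
    leaf : 0 < w % Q → w % Q ≤ leaves (w / Q) → x (w / Q) ≡ true → parent x w ≡ (w / Q) * Q → ParentView x w

  parentView : ∀ x w → ParentView x w
  parentView x w with starLeaf x w in eq
  ... | false = path (cong (λ c → if c then (w / Q) * Q else w ∸ 1) eq)
  ... | true  with ∧-true⁻ {0 <ᵇ w % Q} eq
  ...   | pos , rest with ∧-true⁻ {w % Q <ᵇ suc (leaves (w / Q))} rest
  ...     | small , xi = leaf (<ᵇ-true⁻ pos) (s≤s⁻¹ (<ᵇ-true⁻ small)) xi (cong (λ c → if c then (w / Q) * Q else w ∸ 1) eq)

  parent-< : ∀ x w → 0 < w → parent x w < w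
  parent-< x (suc w) _ with parentView x (suc w)
  ... | path eq = subst (_< suc w) (sym eq) ≤-refl
  ... | leaf pos _ _ eq = subst (_< suc w) (sym eq)
          (subst ((suc w / Q) * Q <_) (sym (decompose (suc w))) (m<n+m _ pos))

  -- The first vertex past the place of the star of block i, not the end of the block.
  blockEnd : ℕ → ℕ
  blockEnd i = suc (i * Q + leaves i)

  blockEnd≤⇒≤block : ∀ {i w} → blockEnd i ≤ w → i ≤ w / Q
  blockEnd≤⇒≤block {i} h = block-mono (≤-trans (m≤m+n (i * Q) (leaves i)) (≤-trans (n≤1+n _) h))

  offset : ∀ {i w d} → w / Q ≡ i → i * Q + d ≤ w → d ≤ w % Q
  offset {i} {w} {d} refl h = +-cancelˡ-≤ (i * Q) d (w % Q)
    (subst (i * Q + d ≤_) (trans (decompose w) (+-comm (w % Q) (i * Q))) h)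

  beyond-leaves : ∀ {i w} → blockEnd i ≤ w → w / Q ≡ i → leaves (w / Q) < w % Q
  beyond-leaves {i} {w} h refl = offset refl (subst (_≤ w) (sym (+-suc (i * Q) (leaves i))) h)

  parent-agree : ∀ {x y} i → (∀ k → i < k → x k ≡ y k) → ∀ w → blockEnd i ≤ w → parent x w ≡ parent y w
  parent-agree {x} {y} i agree w h = cong (λ c → if c then (w / Q) * Q else w ∸ 1) starLeaf≡
    where
    starLeaf≡ : starLeaf x w ≡ starLeaf y w
    starLeaf≡ with m≤n⇒m<n∨m≡n (blockEnd≤⇒≤block {i} {w} h)
    ... | inj₁ i<k = cong (λ c → (0 <ᵇ w % Q) ∧ (w % Q <ᵇ suc (leaves (w / Q))) ∧ c) (agree _ i<k)
    -- Within block i itself, w lies past the place of the leaves, so neither parent depends on the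
    -- bit.
    ... | inj₂ i≡k rewrite <ᵇ-false {w % Q} {suc (leaves (w / Q))} (beyond-leaves {i} {w} h (sym i≡k)) = refl

  -- Between the star of block i and the next centre there is only a path, and later stars have
  -- their centres at or after (i + 1) Q. So a region cut off there grows by a single vertex per
  -- level, which is the locality used for `below`.
  parent-≥ : ∀ y {i r w} → blockEnd i + r ≤ suc i * Q → blockEnd i + r < w → blockEnd i + r ≤ parent y w
  parent-≥ y {i} {r} {w} fits h with parentView y w
  ... | path eq = subst (blockEnd i + r ≤_) (sym eq) (∸-monoˡ-≤ 1 h)
  ... | leaf _ small _ eq with m≤n⇒m<n∨m≡n (blockEnd≤⇒≤block {i} {w} (≤-trans (m≤m+n (blockEnd i) r) (<⇒≤ h)))
  ...   | inj₁ i<k = subst (blockEnd i + r ≤_) (sym eq) (≤-trans fits (*-monoˡ-≤ Q i<k))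
  ...   | inj₂ i≡k = ⊥-elim (<⇒≱ (beyond-leaves {i} {w} (≤-trans (m≤m+n (blockEnd i) r) (<⇒≤ h)) (sym i≡k)) small)

  parent-leaf : ∀ {x i w} → x i ≡ true → blockEnd i ≤ suc i * Q → i * Q < w → w < blockEnd i → parent x w ≡ i * Q
  parent-leaf {x} {i} {w} xi fits above below = trans
      (cong (λ c → if c then (w / Q) * Q else w ∸ 1)
        (∧-true⁺ (<ᵇ-true (offset block (subst (_≤ w) (+-comm 1 (i * Q)) above)))
          (∧-true⁺ (<ᵇ-true (s≤s small)) (trans (cong x block) xi))))
      (cong (_* Q) block)
    where
    block : w / Q ≡ i
    block = ≤-antisym (block-mono′ (<-≤-trans below fits)) (block-mono (<⇒≤ above))
    small : w % Q ≤ leaves (w / Q)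
    small = +-cancelˡ-≤ ((w / Q) * Q) _ _ (begin
      (w / Q) * Q + w % Q              ≡⟨ +-comm _ (w % Q) ⟩
      w % Q + (w / Q) * Q              ≡⟨ sym (decompose w) ⟩
      w                                ≤⟨ s≤s⁻¹ below ⟩
      i * Q + leaves i                 ≡⟨ cong (λ k → k * Q + leaves k) (sym block) ⟩
      (w / Q) * Q + leaves (w / Q)     ∎)
      where open ≤-Reasoning

  child-≤ : ∀ {y i u w} → y i ≡ false → w < suc i * Q → u < w → parent y w ≡ u → w ≤ u + (5 * i + 1)
  child-≤ {y} {i} {u} {suc w} yi low u<w pw with parentView y (suc w)
  ... | path eq = subst (λ z → suc w ≤ z + (5 * i + 1)) (trans (sym eq) pw)
          (subst (_≤ w + (5 * i + 1)) (+-comm w 1) (+-monoʳ-≤ w (m≤n+m 1 (5 * i))))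
  ... | leaf _ small yk eq = begin
        suc w                                ≡⟨ decompose (suc w) ⟩
        suc w % Q + k * Q                    ≡⟨ +-comm (suc w % Q) (k * Q) ⟩
        k * Q + suc w % Q                    ≡⟨ cong (_+ suc w % Q) (trans (sym eq) pw) ⟩
        u + suc w % Q                        ≤⟨ +-monoʳ-≤ u (≤-trans small leaves≤) ⟩
        u + (5 * i + 1)                      ∎
    where
    open ≤-Reasoning
    k = suc w / Q
    k<i : k < i
    k<i = ≤∧≢⇒< (block-mono′ low) (λ k≡i → true≢false (trans (sym yk) (trans (cong y k≡i) yi)))
    leaves≤ : leaves k ≤ 5 * i + 1
    leaves≤ = begin
      5 * k + 6        ≡⟨ solve 1 (λ k → con 5 :* k :+ con 6 := con 5 :* (con 1 :+ k) :+ con 1) refl k ⟩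
      5 * suc k + 1    ≤⟨ +-monoˡ-≤ 1 (*-monoʳ-≤ 5 k<i) ⟩
      5 * i + 1        ∎
      where open +-*-Solver

  child-≤-offBlock : ∀ {y u w} → u % Q ≢ 0 → u < w → parent y w ≡ u → w ≤ u + 1
  child-≤-offBlock {y} {u} {suc w} off u<w pw with parentView y (suc w)
  ... | path eq       = ≤-reflexive (trans (cong suc (trans (sym eq) pw)) (+-comm 1 u))
  ... | leaf _ _ _ eq = ⊥-elim (off (trans (cong (_% Q) (trans (sym pw) eq)) (m*n%n≡0 (suc w / Q) Q)))

  -- No two centres are adjacent: they would be consecutive multiples of Q at distance 1. So every
  -- edge has an end with at most one child.
  edge-offBlock : 2 ≤ Q → ∀ {y u w} → u < w → parent y w ≡ u → u % Q ≢ 0 ⊎ w % Q ≢ 0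
  edge-offBlock Q≥2 {y} {u} {suc w} u<w pw with u % Q ≟ 0
  ... | no off = inj₁ off
  ... | yes onu with parentView y (suc w)
  ...   | leaf pos _ _ _ = inj₂ (λ e → <⇒≢ pos (sym e))
  ...   | path eq = inj₂ (λ onw → <⇒≢ Q≥2 (sym (∣1⇒≡1 (∣m+n∣m⇒∣n
            (subst (Q ∣_) (+-comm 1 u) (subst (λ z → Q ∣ suc z) (trans (sym eq) pw) (m%n≡0⇒n∣m (suc w) Q onw)))
            (m%n≡0⇒n∣m u Q onu)))))

-- Powers of (β + 1) / β

^-distribʳ-* : ∀ k m n → (m * n) ^ k ≡ m ^ k * n ^ k
^-distribʳ-* zero    m n = refl
^-distribʳ-* (suc k) m n = trans (cong (m * n *_) (^-distribʳ-* k m n)) ([m*n]*[o*p]≡[m*o]*[n*p] m n (m ^ k) (n ^ k))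

-- This is (1 + 1/β)^k ≥ 1 + k/β, multiplied by β^(k + 1).
bernoulli : ∀ β k → (β + k) * β ^ k ≤ β * suc β ^ k
bernoulli β zero    = ≤-reflexive (cong (_* 1) (+-identityʳ β))
bernoulli β (suc k) = begin
  (β + suc k) * (β * β ^ k)
    ≡⟨ solve 3 (λ b k x → (b :+ (con 1 :+ k)) :* (b :* x) := (b :* (b :+ k) :+ b) :* x) refl β k (β ^ k) ⟩
  (β * (β + k) + β) * β ^ k
    ≤⟨ *-monoˡ-≤ (β ^ k) (+-monoʳ-≤ (β * (β + k)) (m≤m+n β k)) ⟩
  (β * (β + k) + (β + k)) * β ^ k
    ≡⟨ solve 3 (λ b k x → (b :* (b :+ k) :+ (b :+ k)) :* x := (con 1 :+ b) :* ((b :+ k) :* x)) refl β k (β ^ k) ⟩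
  suc β * ((β + k) * β ^ k)
    ≤⟨ *-monoʳ-≤ (suc β) (bernoulli β k) ⟩
  suc β * (β * suc β ^ k)
    ≡⟨ solve 2 (λ b y → (con 1 :+ b) :* (b :* y) := b :* ((con 1 :+ b) :* y)) refl β (suc β ^ k) ⟩
  β * (suc β * suc β ^ k) ∎
  where
  open ≤-Reasoning
  open +-*-Solver

-- So β levels gain a factor 2, and β m levels gain 2^m; this fixes the depth at which two trees are
-- compared.
doubling : ∀ β .{{_ : NonZero β}} → 2 * β ^ β ≤ suc β ^ β
doubling β = *-cancelˡ-≤ β (begin
  β * (2 * β ^ β)     ≡⟨ solve 2 (λ b x → b :* (con 2 :* x) := (b :+ b) :* x) refl β (β ^ β) ⟩
  (β + β) * β ^ β     ≤⟨ bernoulli β β ⟩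
  β * suc β ^ β       ∎)
  where
  open ≤-Reasoning
  open +-*-Solver

growth-gap : ∀ {N m} β .{{_ : NonZero β}} → N < 2 ^ m → N * β ^ (β * m) < suc β ^ (β * m)
growth-gap {N} {m} β N<2^m = begin-strict
  N * β ^ (β * m)        <⟨ *-monoˡ-< (β ^ (β * m)) {{m^n≢0 β (β * m)}} N<2^m ⟩
  2 ^ m * β ^ (β * m)    ≡⟨ cong (2 ^ m *_) (sym (^-*-assoc β β m)) ⟩
  2 ^ m * (β ^ β) ^ m    ≡⟨ sym (^-distribʳ-* m 2 (β ^ β)) ⟩
  (2 * β ^ β) ^ m        ≤⟨ ^-monoˡ-≤ m (doubling β) ⟩
  (suc β ^ β) ^ m        ≡⟨ ^-*-assoc (suc β) β m ⟩
  suc β ^ (β * m)        ∎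
  where open ≤-Reasoning

-- Comparison of two star trees

ends-parent : ∀ {n p} e → let u , v = ends (parentTree n p) e in p (toℕ v) ≡ toℕ u
ends-parent {n} {p} e =
  [ proj₂ , (λ (v<u , _) → ⊥-elim (<-asym v<u (ends-< (parentTree n p) e))) ]′
    (parentAdj⁻ {p} {toℕ (proj₁ (ends (parentTree n p) e))} (ends-adj (parentTree n p) e))

deg≤size : ∀ G q u → deg G q u ≤ size G
deg≤size G q u = ≤-trans (≤-reflexive (sum-cong-≗ (λ w → sym (𝟙-∧ (adj G u w) (q w))))) (cnt≤size (λ w → adj G u w ∧ q w))

module _ (n Q : ℕ) .{{_ : NonZero Q}} (Q≥2 : 2 ≤ Q) where

  starTree : (ℕ → Bool) → Graph
  starTree x = parentTree n (parent Q x)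

  starTree-isTree : ∀ x → IsTree (starTree x)
  starTree-isTree x = parentTree-isTree (parent-< Q x) n

  module _ (i t : ℕ) (fits : blockEnd Q i + suc t ≤ suc i * Q) (inside : suc i * Q ≤ n) where

    private
      α β P : ℕ
      β = 5 * i + 2
      α = suc β
      P = blockEnd Q i

      P≤ : P ≤ suc i * Q
      P≤ = ≤-trans (m≤m+n P (suc t)) fits

      above star : Fin n → Bool
      above v = P <ᵇ suc (toℕ v)
      star v = (i * Q <ᵇ suc (toℕ v)) ∧ (toℕ v <ᵇ P)

      below : ℕ → Fin n → Bool
      below r v = toℕ v <ᵇ P + r

      below⁻ : ∀ r v → below r v ≡ true → toℕ v < P + r
      below⁻ r v = <ᵇ-true⁻ {toℕ v} {P + r}

      below⁺ : ∀ r v → toℕ v < P + r → below r v ≡ true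
      below⁺ r v = <ᵇ-true {toℕ v} {P + r}

      star⁻ : ∀ {v} → star v ≡ true → i * Q ≤ toℕ v × toℕ v < P
      star⁻ {v} h = s≤s⁻¹ (<ᵇ-true⁻ (proj₁ (∧-true⁻ h))) , <ᵇ-true⁻ (proj₂ (∧-true⁻ {i * Q <ᵇ suc (toℕ v)} h))

      star⁺ : ∀ {v} → i * Q ≤ toℕ v → toℕ v < P → star v ≡ true
      star⁺ h k = ∧-true⁺ (<ᵇ-true (s≤s h)) (<ᵇ-true k)

    module _ {x : ℕ → Bool} (xi : x i ≡ true) where

      private
        X = starTree x
        simple : IsSimple X
        simple = parentTree-simple {parent Q x} n

        spoke : Fin (leaves i) → Fin n
        spoke k = fromℕ< (<-≤-trans (s≤s (+-monoʳ-< (i * Q) (Fin.toℕ<n k))) (≤-trans P≤ inside))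

        toℕ-spoke : ∀ k → toℕ (spoke k) ≡ suc (i * Q + toℕ k)
        toℕ-spoke k = Fin.toℕ-fromℕ< _

        spoke-star : ∀ k → star (spoke k) ≡ true × i * Q < toℕ (spoke k) × toℕ (spoke k) < P
        spoke-star k = star⁺ (<⇒≤ lo) hi , lo , hi
          where
          lo : i * Q < toℕ (spoke k)
          lo = subst (i * Q <_) (sym (toℕ-spoke k)) (s≤s (m≤m+n (i * Q) (toℕ k)))
          hi : toℕ (spoke k) < P
          hi = subst (_< P) (sym (toℕ-spoke k)) (s≤s (+-monoʳ-< (i * Q) (Fin.toℕ<n k)))

        spoke-adj : ∀ c → toℕ c ≡ i * Q → ∀ k → adj X c (spoke k) ≡ true
        spoke-adj c c≡ k = let _ , lo , hi = spoke-star k in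
          parentAdj⁺ {parent Q x} (subst (_< toℕ (spoke k)) (sym c≡) lo) (trans (parent-leaf Q {x} xi P≤ lo hi) (sym c≡))

        centre-deg : ∀ c → toℕ c ≡ i * Q → leaves i ≤ deg X star c
        centre-deg c c≡ = begin
          leaves i                                        ≡⟨ sym (cnt-all (leaves i)) ⟩
          cnt {leaves i} (λ _ → true)
            ≤⟨ cnt-injection (λ _ → true) (λ w → adj X c w ∧ star w) (λ k _ → spoke k)
                 (λ k _ → ∧-true⁺ (spoke-adj c c≡ k) (proj₁ (spoke-star k)))
                 (λ k l _ _ eq → Fin.toℕ-injective (+-cancelˡ-≡ (i * Q) _ _ (suc-injective
                   (trans (sym (toℕ-spoke k)) (trans (cong toℕ eq) (toℕ-spoke l)))))) ⟩
          cnt (λ w → adj X c w ∧ star w)                  ≡⟨ sum-cong-≗ (λ w → 𝟙-∧ (adj X c w) (star w)) ⟩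
          deg X star c                                    ∎
          where open ≤-Reasoning

      -- Degrees are counted within the star: the centre has `leaves i` neighbours, a leaf has at
      -- least one, and subtracting 2 leaves 5 i + 5 = α + 2.
      star-edge-deg : ∀ e → lift X star e ≡ true → α + 2 ≤ deg (L X) (lift X star) e
      star-edge-deg e le = +-cancelʳ-≤ 2 _ _ (begin
        α + 2 + 2                        ≡⟨ solve 1 (λ i → con 1 :+ (con 5 :* i :+ con 2) :+ con 2 :+ con 2 := con 5 :* i :+ con 6 :+ con 1) refl i ⟩
        leaves i + 1                     ≤⟨ +-mono-≤ (centre-deg u u≡) leaf-deg ⟩
        deg X star u + deg X star v      ≡⟨ sym (deg-lift simple star e le) ⟩
        deg (L X) (lift X star) e + 2    ∎)
        where
        open ≤-Reasoning
        open +-*-Solver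
        u = proj₁ (ends X e)
        v = proj₂ (ends X e)
        su : star u ≡ true
        su = proj₁ (∧-true⁻ le)
        sv : star v ≡ true
        sv = proj₂ (∧-true⁻ {star u} le)
        u≡ : toℕ u ≡ i * Q
        u≡ = trans (sym (ends-parent {n} {parent Q x} e))
               (parent-leaf Q {x} xi P≤ (≤-<-trans (proj₁ (star⁻ {u} su)) (ends-< X e)) (proj₂ (star⁻ {v} sv)))
        leaf-deg : 1 ≤ deg X star v
        leaf-deg = ≤-trans (≤-reflexive (sym (cong₂ (λ a b → 𝟙 a * 𝟙 b) (trans (proj₁ simple v u) (ends-adj X e)) su)))
          (term≤sum (λ w → 𝟙 (adj X v w) * 𝟙 (star w)) u)

      star-nonempty : 1 ≤ cnt (lift X star)
      star-nonempty = *-cancelˡ-< 2 0 _ (begin-strict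
        0                                              <⟨ ≤-trans (s≤s z≤n) (≤-trans (m≤n+m 6 (5 * i)) (centre-deg c c≡)) ⟩
        deg X star c                                   ≡⟨ sym (+-identityʳ _) ⟩
        1 * deg X star c                               ≡⟨ cong (λ b → 𝟙 b * deg X star c) (sym sc) ⟩
        𝟙 (star c) * deg X star c                      ≤⟨ term≤sum (λ u → 𝟙 (star u) * deg X star u) c ⟩
        sum (λ u → 𝟙 (star u) * deg X star u)          ≡⟨ sym (handshake simple star) ⟩
        2 * cnt (lift X star)                          ∎)
        where
        open ≤-Reasoning
        iQ<P : i * Q < P
        iQ<P = s≤s (m≤m+n (i * Q) (leaves i))
        c : Fin n
        c = fromℕ< (<-≤-trans iQ<P (≤-trans P≤ inside))
        c≡ : toℕ c ≡ i * Q
        c≡ = Fin.toℕ-fromℕ< _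
        sc : star c ≡ true
        sc = star⁺ (≤-reflexive (sym c≡)) (subst (_< P) (sym c≡) iQ<P)

    module _ {y : ℕ → Bool} (yi : y i ≡ false) where

      private
        Y = starTree y
        simple : IsSimple Y
        simple = parentTree-simple {parent Q y} n
        b = below (suc t)

        b⁻ : ∀ {w} → b w ≡ true → toℕ w < suc i * Q
        b⁻ {w} h = <-≤-trans (below⁻ (suc t) w h) fits

        deg-≤ : ∀ u → deg Y b u ≤ β
        deg-≤ u = ≤-trans (parentTree-deg-≤ {n} {parent Q y} b u (5 * i + 1) (λ w bw u<w pw → child-≤ Q {y} {i} yi (b⁻ {w} bw) u<w pw))
          (≤-reflexive (sym (+-suc (5 * i) 1)))

        deg-≤2 : ∀ u → toℕ u % Q ≢ 0 → deg Y b u ≤ 2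
        deg-≤2 u off = parentTree-deg-≤ {n} {parent Q y} b u 1 (λ w _ u<w pw → child-≤-offBlock Q {y} off u<w pw)

      -- The end that is not a multiple of Q has degree at most 2, which the -2 of the line graph
      -- cancels; the other end contributes at most β.
      below-edge-deg : ∀ e → lift Y b e ≡ true → deg (L Y) (lift Y b) e ≤ β
      below-edge-deg e le = +-cancelʳ-≤ 2 _ _ (subst (_≤ β + 2) (sym (deg-lift simple b e le)) ends-deg)
        where
        u = proj₁ (ends Y e)
        v = proj₂ (ends Y e)
        ends-deg : deg Y b u + deg Y b v ≤ β + 2
        ends-deg =
          [ (λ off → subst (_≤ β + 2) (+-comm (deg Y b v) (deg Y b u)) (+-mono-≤ (deg-≤ v) (deg-≤2 u off)))
          , (λ off → +-mono-≤ (deg-≤ u) (deg-≤2 v off))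
          ]′ (edge-offBlock Q Q≥2 {y} (ends-< Y e) (ends-parent {n} {parent Q y} e))

      below-edges : cnt (lift Y b) ≤ n * n
      below-edges = begin
        cnt (lift Y b)        ≤⟨ m≤n*m _ 2 ⟩
        2 * cnt (lift Y b)    ≤⟨ handshake-≤ simple b n (λ u _ → deg≤size Y b u) ⟩
        cnt b * n             ≤⟨ *-monoˡ-≤ n (cnt≤size b) ⟩
        n * n                 ∎
        where open ≤-Reasoning

      below-exhaustion : Exhaustion Y above below (suc t)
      below-exhaustion = record { start = start′ ; grow = grow′ ; spread = spread′ }
        where
        start′ : ∀ u → above u ≡ true ⊎ below 0 u ≡ true
        start′ u with toℕ u <? P
        ... | yes u<P = inj₂ (below⁺ 0 u (subst (toℕ u <_) (sym (+-identityʳ P)) u<P))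
        ... | no u≮P  = inj₁ (<ᵇ-true (s≤s (≮⇒≥ u≮P)))
        grow′ : ∀ r → r < suc t → ∀ u → below r u ≡ true → below (suc r) u ≡ true
        grow′ r _ u h = below⁺ (suc r) u (<-≤-trans (below⁻ r u h) (+-monoʳ-≤ P (n≤1+n r)))
        spread′ : ∀ r → r < suc t → ∀ u w → adj Y u w ≡ true → below r u ≡ true → below (suc r) w ≡ true
        spread′ r r<t u w a h with parentAdj⁻ {parent Q y} {toℕ u} {toℕ w} a
        ... | inj₂ (w<u , _) = grow′ r r<t w (below⁺ r w (<-trans w<u (below⁻ r u h)))
        ... | inj₁ (u<w , pw≡u) with toℕ w ≤? P + r
        ...   | yes w≤ = below⁺ (suc r) w (subst (toℕ w <_) (sym (+-suc P r)) (s≤s w≤))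
        ...   | no w≰  = ⊥-elim (<⇒≱ (below⁻ r u h) (subst (P + r ≤_) pw≡u
                  (parent-≥ Q y {i} {r} (≤-trans (+-monoʳ-≤ P (<⇒≤ r<t)) fits) (≰⇒> w≰))))

    above-embedding : ∀ {x y} → (∀ k → i < k → x k ≡ y k) →
      PartialEmbedding (starTree y) (starTree x) above above _≡_
    above-embedding {x} {y} agree = record
      { total      = λ u h → u , refl , h
      ; functional = λ { refl refl → refl }
      ; injective  = λ { refl refl → refl }
      ; preserves  = λ { {u} {v} qu qv refl refl a → subst (_≡ true) (parentAdj≡ u v qu qv) a }
      }
      where
      parent≡ : ∀ u → above u ≡ true → parent Q y (toℕ u) ≡ parent Q x (toℕ u)
      parent≡ u h = sym (parent-agree Q {x} {y} i agree (toℕ u) (s≤s⁻¹ (<ᵇ-true⁻ h)))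
      parentAdj≡ : ∀ u v → above u ≡ true → above v ≡ true →
        parentAdj (parent Q y) (toℕ u) (toℕ v) ≡ parentAdj (parent Q x) (toℕ u) (toℕ v)
      parentAdj≡ u v qu qv = cong₂ (λ a b → ((toℕ u <ᵇ toℕ v) ∧ (a ≡ᵇ toℕ u)) ∨ ((toℕ v <ᵇ toℕ u) ∧ (b ≡ᵇ toℕ v)))
        (parent≡ v qv) (parent≡ u qu)

    starTree-size-< : ∀ {x y} → x i ≡ true → y i ≡ false → (∀ k → i < k → x k ≡ y k) →
      n * n * β ^ t < α ^ t → size (Liter (suc t) (starTree y)) < size (Liter (suc t) (starTree x))
    starTree-size-< {x} {y} xi yi agree gap = begin-strict
      size (Liter j Y)
        ≤⟨ cnt-cover (liftIter Y j above) (liftIter Y j (below j))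
             (liftIter-cover {Y} simpleY {above} {below} j (below-exhaustion {y} yi)) ⟩
      cnt (liftIter Y j above) + cnt (liftIter Y j (below j))
        <⟨ +-mono-≤-< (embedding-cnt {Y} {X} {above} {above} {_≡_} simpleX (above-embedding {x} {y} agree) j)
             (growth-< {X} {Y} simpleX simpleY star (below j) α β
               (star-edge-deg {x} xi) (below-edge-deg {y} yi) (n * n) (star-nonempty {x} xi) (below-edges {y} yi) t gap) ⟩
      cnt (liftIter X j above) + cnt (liftIter X j star)
        ≤⟨ cnt-disjoint (liftIter X j above) (liftIter X j star) (liftIter-disjoint X above star disjoint j) ⟩
      size (Liter j X) ∎
      where
      open ≤-Reasoning
      j = suc t
      X = starTree x
      Y = starTree y
      simpleX : IsSimple X
      simpleX = parentTree-simple {parent Q x} n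
      simpleY : IsSimple Y
      simpleY = parentTree-simple {parent Q y} n
      disjoint : ∀ u → above u ≡ true → star u ≡ true → ⊥
      disjoint u a s = <⇒≱ (proj₂ (star⁻ {u} s)) (s≤s⁻¹ (<ᵇ-true⁻ a))

-- Bit strings and their last difference

funToFin-cong : ∀ {m n} {f g : Fin m → Fin n} → f ≗ g → funToFin f ≡ funToFin g
funToFin-cong {zero}  h = refl
funToFin-cong {suc m} h = cong₂ combine (h zero) (funToFin-cong (h ∘ suc))

bit : Fin 2 → Bool
bit zero    = false
bit (suc _) = true

bit-injective : ∀ {a b} → bit a ≡ bit b → a ≡ b
bit-injective {zero}     {zero}     _ = refl
bit-injective {suc zero} {suc zero} _ = refl

bits : ∀ k → Fin (2 ^ k) → ℕ → Bool
bits k c i with i <? k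
... | yes i<k = bit (finToFun {2} {k} c (fromℕ< i<k))
-- From block k on every tree is a bare path, so any two of them agree there, as `last-difference`
-- requires.
... | no _    = false

bits-≥ : ∀ k c {i} → k ≤ i → bits k c i ≡ false
bits-≥ k c {i} k≤i with i <? k
... | yes i<k = ⊥-elim (<⇒≱ i<k k≤i)
... | no _    = refl

bits-toℕ : ∀ k c (i : Fin k) → bits k c (toℕ i) ≡ bit (finToFun {2} {k} c i)
bits-toℕ k c i with toℕ i <? k
... | yes i<k = cong (bit ∘ finToFun {2} {k} c) (Fin.fromℕ<-toℕ i i<k)
... | no i≮k  = ⊥-elim (i≮k (Fin.toℕ<n i))

bits-injective : ∀ k c d → (∀ i → bits k c i ≡ bits k d i) → c ≡ d
bits-injective k c d h = begin
  c                                   ≡⟨ sym (Fin.funToFin-finToFin {k} {2} c) ⟩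
  funToFin (finToFun {2} {k} c)       ≡⟨ funToFin-cong (λ i → bit-injective
                                           (trans (sym (bits-toℕ k c i)) (trans (h (toℕ i)) (bits-toℕ k d i)))) ⟩
  funToFin (finToFun {2} {k} d)       ≡⟨ Fin.funToFin-finToFin {k} {2} d ⟩
  d                                   ∎
  where open ≡-Reasoning

last-difference : ∀ k (x y : ℕ → Bool) → (∀ i → k ≤ i → x i ≡ y i) →
  (∀ i → x i ≡ y i) ⊎ ∃ λ i → i < k × x i ≢ y i × (∀ l → i < l → x l ≡ y l)
last-difference zero    x y agree = inj₁ (λ i → agree i z≤n)
last-difference (suc k) x y agree with x k Bool.≟ y k
... | no x≢y = inj₂ (k , ≤-refl , x≢y , agree)
... | yes x≡y with last-difference k x y agree′
  where
  agree′ : ∀ i → k ≤ i → x i ≡ y i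
  agree′ i k≤i with m≤n⇒m<n∨m≡n k≤i
  ... | inj₁ k<i  = agree i k<i
  ... | inj₂ refl = x≡y
...   | inj₁ all                = inj₁ all
...   | inj₂ (i , i<k , differ) = inj₂ (i , m<n⇒m<1+n i<k , differ)

-- Logarithms and the seventh power

2^d≤n⇒d≤⌈log₂n⌉ : ∀ d {n} → 2 ^ d ≤ n → d ≤ ⌈log₂ n ⌉
2^d≤n⇒d≤⌈log₂n⌉ d {n} h = subst (_≤ ⌈log₂ n ⌉) (⌈log₂2^n⌉≡n d) (⌈log₂⌉-mono-≤ h)

-- Derived only from monotonicity and the values at powers of 2; the spare factor 2 is absorbed in
-- the choice of `m`.
n≤2^[1+⌈log₂n⌉] : ∀ n → n ≤ 2 ^ suc ⌈log₂ n ⌉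
n≤2^[1+⌈log₂n⌉] n = ≮⇒≥ λ 2^<n →
  <⇒≱ ≤-refl (2^d≤n⇒d≤⌈log₂n⌉ (suc ⌈log₂ n ⌉) (<⇒≤ 2^<n))

2^ℓ≤n : ∀ n {ℓ} → ⌈log₂ n ⌉ ≡ suc ℓ → 2 ^ ℓ ≤ n
2^ℓ≤n n {ℓ} eq = ≮⇒≥ λ n<2^ℓ →
  <⇒≱ ≤-refl (subst₂ _≤_ eq (⌈log₂2^n⌉≡n ℓ) (⌈log₂⌉-mono-≤ (<⇒≤ n<2^ℓ)))

-- (1 + 1/16)⁷ ≤ 2
[1+c]^7≤2*c^7 : ∀ c → 16 ≤ c → suc c ^ 7 ≤ 2 * c ^ 7
[1+c]^7≤2*c^7 c 16≤c = *-cancelˡ-≤ (16 ^ 7) (begin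
  16 ^ 7 * suc c ^ 7       ≡⟨ sym (^-distribʳ-* 7 16 (suc c)) ⟩
  (16 * suc c) ^ 7         ≤⟨ ^-monoˡ-≤ 7 (≤-trans (≤-reflexive (*-suc 16 c)) (+-monoˡ-≤ (16 * c) 16≤c)) ⟩
  (17 * c) ^ 7             ≡⟨ ^-distribʳ-* 7 17 c ⟩
  17 ^ 7 * c ^ 7           ≤⟨ *-monoˡ-≤ (c ^ 7) (≤ᵇ⇒≤ (17 ^ 7) (16 ^ 7 * 2) tt) ⟩
  16 ^ 7 * 2 * c ^ 7       ≡⟨ *-assoc (16 ^ 7) 2 (c ^ 7) ⟩
  16 ^ 7 * (2 * c ^ 7)     ∎)
  where open ≤-Reasoning

-- Raising the base by one at most doubles the left side and exactly doubles the right one.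
power≤exponential : ∀ {c e} → 16 ≤ c → c ^ 7 ≤ 2 ^ e → ∀ d → (d + c) ^ 7 ≤ 2 ^ (d + e)
power≤exponential         16≤c base zero    = base
power≤exponential {c} {e} 16≤c base (suc d) = begin
  suc (d + c) ^ 7        ≤⟨ [1+c]^7≤2*c^7 (d + c) (≤-trans 16≤c (m≤n+m c d)) ⟩
  2 * (d + c) ^ 7        ≤⟨ *-monoʳ-≤ 2 (power≤exponential 16≤c base d) ⟩
  2 * 2 ^ (d + e)        ∎
  where open ≤-Reasoning

64^7≤2^63 : 64 ^ 7 ≤ 2 ^ 63
64^7≤2^63 = ≤ᵇ⇒≤ (64 ^ 7) (2 ^ 63) tt

-- Choice of the parameters

module _ (n : ℕ) (ℓ≥64 : 64 ≤ ⌈log₂ n ⌉) where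

  private
    -- From n ≤ 2^(ℓ + 1) comes n² ≤ 2^(2 ℓ + 2), and one more unit in `m` makes this strict. For i
    -- < ℓ² the star and the depth (5 i + 2) m take up at most 36 ℓ³ vertices, which fit into Q =
    -- ℓ^5. The blocks then occupy k Q = ℓ^7 vertices, at most 2^(ℓ - 1) ≤ n; the threshold 64
    -- leaves room, as 64^7 = 2^42.
    ℓ k Q m : ℕ
    ℓ = ⌈log₂ n ⌉
    k = ℓ ^ 2
    Q = ℓ ^ 5
    m = 2 * ℓ + 3

    ℓ-pos : 1 ≤ ℓ
    ℓ-pos = ≤-trans (≤ᵇ⇒≤ 1 64 tt) ℓ≥64

    instance
      ℓ-nonZero : NonZero ℓ
      ℓ-nonZero = >-nonZero ℓ-pos
      Q-nonZero : NonZero Q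
      Q-nonZero = m^n≢0 ℓ 5

    Q≥2 : 2 ≤ Q
    Q≥2 = ≤-trans (≤ᵇ⇒≤ 2 64 tt) (≤-trans ℓ≥64 (m≤m*n ℓ (ℓ ^ 4) {{m^n≢0 ℓ 4}}))

    kQ≤n : k * Q ≤ n
    kQ≤n = go ℓ refl ℓ≥64
      where
      go : ∀ l → ℓ ≡ l → 64 ≤ l → l ^ 2 * l ^ 5 ≤ n
      go l eq h = subst (λ z → z ^ 2 * z ^ 5 ≤ n) (m∸n+n≡m h) (begin
        (d + 64) ^ 2 * (d + 64) ^ 5     ≡⟨ sym (^-distribˡ-+-* (d + 64) 2 5) ⟩
        (d + 64) ^ 7                    ≤⟨ power≤exponential (≤ᵇ⇒≤ 16 64 tt) 64^7≤2^63 d ⟩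
        2 ^ (d + 63)                    ≤⟨ 2^ℓ≤n n (trans eq (trans (sym (m∸n+n≡m h)) (+-suc d 63))) ⟩
        n                               ∎)
        where
        open ≤-Reasoning
        d = l ∸ 64

    n²<2^m : n * n < 2 ^ m
    n²<2^m = begin-strict
      n * n                     ≤⟨ *-mono-≤ (n≤2^[1+⌈log₂n⌉] n) (n≤2^[1+⌈log₂n⌉] n) ⟩
      2 ^ suc ℓ * 2 ^ suc ℓ     ≡⟨ sym (^-distribˡ-+-* 2 (suc ℓ) (suc ℓ)) ⟩
      2 ^ (suc ℓ + suc ℓ)       <⟨ ^-monoʳ-< 2 (s≤s (s≤s z≤n)) (≤-reflexive
          (solve 1 (λ l → con 1 :+ ((con 1 :+ l) :+ (con 1 :+ l)) := con 2 :* l :+ con 3) refl ℓ)) ⟩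
      2 ^ m                     ∎
      where
      open ≤-Reasoning
      open +-*-Solver

    depth : ℕ → ℕ
    depth i = (5 * i + 2) * m

    fits : ∀ i → i < k → blockEnd Q i + suc (depth i) ≤ suc i * Q
    fits i i<k = begin
      suc (i * Q + (5 * i + 6)) + suc ((5 * i + 2) * (2 * ℓ + 3))
        ≡⟨ solve 3 (λ q i l → con 1 :+ (q :+ (con 5 :* i :+ con 6)) :+ (con 1 :+ (con 5 :* i :+ con 2) :* (con 2 :* l :+ con 3))
             := (con 5 :* i :+ con 2) :* (con 2 :* l :+ con 4) :+ con 6 :+ q) refl (i * Q) i ℓ ⟩
      (5 * i + 2) * (2 * ℓ + 4) + 6 + i * Q
        ≤⟨ +-monoˡ-≤ (i * Q) (+-mono-≤ (*-mono-≤ 5i+2≤5k 2ℓ+4≤6ℓ) (m≤m*n 6 (ℓ ^ 3) {{m^n≢0 ℓ 3}})) ⟩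
      5 * k * (6 * ℓ) + 6 * ℓ ^ 3 + i * Q
        ≡⟨ cong (_+ i * Q) (solve 1 (λ l → con 5 :* (l :^ 2) :* (con 6 :* l) :+ con 6 :* (l :^ 3) := con 36 :* (l :^ 3)) refl ℓ) ⟩
      36 * ℓ ^ 3 + i * Q
        ≤⟨ +-monoˡ-≤ (i * Q) (*-monoˡ-≤ (ℓ ^ 3) (≤-trans (≤-trans (≤ᵇ⇒≤ 36 64 tt) ℓ≥64) (m≤m*n ℓ (ℓ ^ 1) {{m^n≢0 ℓ 1}}))) ⟩
      ℓ ^ 2 * ℓ ^ 3 + i * Q
        ≡⟨ cong (_+ i * Q) (sym (^-distribˡ-+-* ℓ 2 3)) ⟩
      suc i * Q ∎
      where
      open ≤-Reasoning
      open +-*-Solver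
      5i+2≤5k : 5 * i + 2 ≤ 5 * k
      5i+2≤5k = ≤-trans (+-monoʳ-≤ (5 * i) (≤ᵇ⇒≤ 2 5 tt))
        (≤-trans (≤-reflexive (trans (+-comm (5 * i) 5) (sym (*-suc 5 i)))) (*-monoʳ-≤ 5 i<k))
      2ℓ+4≤6ℓ : 2 * ℓ + 4 ≤ 6 * ℓ
      2ℓ+4≤6ℓ = ≤-trans (+-monoʳ-≤ (2 * ℓ) (*-monoʳ-≤ 4 ℓ-pos)) (≤-reflexive (sym (*-distribʳ-+ ℓ 2 4)))

    tree : (ℕ → Bool) → Graph
    tree = starTree n Q Q≥2

    separated : ∀ {x y} i → i < k → x i ≡ true → y i ≡ false → (∀ l → i < l → x l ≡ y l) →
      size (Liter (suc (depth i)) (tree y)) < size (Liter (suc (depth i)) (tree x))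
    separated {x} {y} i i<k xi yi agree =
      starTree-size-< n Q Q≥2 i (depth i) (fits i i<k) (≤-trans (*-monoˡ-≤ Q i<k) kQ≤n) {x} {y} xi yi agree
        (growth-gap {n * n} {m} (5 * i + 2) {{>-nonZero (≤-trans (s≤s z≤n) (m≤n+m 2 (5 * i)))}} n²<2^m)

    inequivalent : ∀ x y → (∀ i → k ≤ i → x i ≡ y i) → ¬ (∀ i → x i ≡ y i) → ¬ GrahamEquiv (tree x) (tree y)
    inequivalent x y agree differ equiv = [ differ , contradict ]′ (last-difference k x y agree)
      where
      contradict : ¬ ∃ λ i → i < k × x i ≢ y i × (∀ l → i < l → x l ≡ y l)
      contradict (i , i<k , xi≢yi , above) = cases (x i) (y i) refl refl
        where
        cases : ∀ a b → x i ≡ a → y i ≡ b → ⊥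
        cases true  true  xi yi = xi≢yi (trans xi (sym yi))
        cases false false xi yi = xi≢yi (trans xi (sym yi))
        cases true  false xi yi = <⇒≢ (separated {x} {y} i i<k xi yi above) (sym (equiv (suc (depth i))))
        cases false true  xi yi = <⇒≢ (separated {y} {x} i i<k yi xi (λ l h → sym (above l h))) (equiv (suc (depth i)))

  -- A root-free form of k ≥ (log n)^(3/2), with the constant 1; k = (log n)² satisfies it with room
  -- to spare.
  log³≤k² : ⌈log₂ n ⌉ ^ 3 ≤ (1 * ⌈log₂ n ⌉ ^ 2) ^ 2
  log³≤k² = begin
    ℓ ^ 3                ≤⟨ ^-monoʳ-≤ ℓ (≤ᵇ⇒≤ 3 4 tt) ⟩
    ℓ ^ 4                ≡⟨ sym (^-*-assoc ℓ 2 2) ⟩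
    (ℓ ^ 2) ^ 2          ≡⟨ cong (_^ 2) (sym (*-identityˡ (ℓ ^ 2))) ⟩
    (1 * ℓ ^ 2) ^ 2      ∎
    where open ≤-Reasoning

  manyGrahamClasses : AtLeastGrahamClasses n (2 ^ (⌈log₂ n ⌉ ^ 2))
  manyGrahamClasses = (λ c → tree (bits k c)) ,
    (λ c → starTree-isTree n Q Q≥2 (bits k c) , refl) ,
    (λ c d c≢d → inequivalent (bits k c) (bits k d)
      (λ i k≤i → trans (bits-≥ k c k≤i) (sym (bits-≥ k d k≤i))) (λ same → c≢d (bits-injective k c d same)))

mainTheorem1 : Σ ℕ λ b → Σ ℕ λ N → ∀ n → N ≤ n →
    Σ ℕ λ k → (⌈log₂ n ⌉ ^ 3 ≤ (b * k) ^ 2) × AtLeastGrahamClasses n (2 ^ k)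
mainTheorem1 = 1 , 2 ^ 64 , λ n 2^64≤n →
  let ℓ≥64 = 2^d≤n⇒d≤⌈log₂n⌉ 64 2^64≤n
  in ⌈log₂ n ⌉ ^ 2 , log³≤k² n ℓ≥64 , manyGrahamClasses n ℓ≥64
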